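{- Let $n\ge 1$. Suppose the pair $(T,r)$, where $T$ is a tree with $n$ vertices and $r$ is a vertex of $T$, maximizes the local mean subtree order $\mu_T(r)$ among all such pairs. Then $T$ is a broom, i.e., a tree consisting of a path together with leaves attached to one end of the path, and $r$ is the other end of the path.
   Context: A subtree of a tree $T$ is a (nonempty) induced connected subgraph of $T$. For a vertex $r$ of $T$, the local mean subtree order $\mu_T(r)$ is the average number of vertices of a subtree of $T$, averaged over all subtrees of $T$ that contain $r$. -}

module Defs where

open import Data.Nat using (ℕ; zero; suc)
open import Data.Bool using (Bool; true; false)
open import Data.Fin using (Fin)
open import Data.Fin.Subset using (Subset; ⊤; ∣_∣) renaming (_∈_ to _∈ₛ_)
open import Data.List using (List; []; _∷_; map; length)
open import Data.Nat.ListAction using (sum)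
import Data.List.NonEmpty as L⁺
open import Data.List.Membership.Propositional using () renaming (_∈_ to _∈ˡ_; _∉_ to _∉ˡ_)
open import Data.List.Relation.Unary.Unique.Propositional using (Unique)
open import Data.Product using (Σ; ∃; _×_; _,_)
open import Data.Sum using (_⊎_)
open import Data.Integer using (+_)
open import Data.Rational using (ℚ; 0ℚ; _/_)
open import Function.Bundles using (_⇔_)
open import Relation.Nullary using (¬_)
open import Relation.Binary.PropositionalEquality using (_≡_)

record Graph (n : ℕ) : Set where
  field
    adj    : Fin n → Fin n → Bool
    sym    : ∀ u v → adj u v ≡ adj v u
    irrefl : ∀ u → adj u u ≡ false

open Graph public

Adj : ∀ {n} → Graph n → Fin n → Fin n → Set
Adj G u v = adj G u v ≡ true

data WalkIn {n} (G : Graph n) (S : Subset n) : Fin n → Fin n → Set where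
  here : ∀ {u} → u ∈ₛ S → WalkIn G S u u
  step : ∀ {u w v} → u ∈ₛ S → Adj G u w → WalkIn G S w v → WalkIn G S u v

Connected : ∀ {n} → Graph n → Set
Connected G = ∀ u v → WalkIn G ⊤ u v

data Chain {n} (G : Graph n) : List (Fin n) → Set where
  nil  : Chain G []
  one  : ∀ x → Chain G (x ∷ [])
  cons : ∀ {x y xs} → Adj G x y → Chain G (y ∷ xs) → Chain G (x ∷ y ∷ xs)

HasCycle : ∀ {n} → Graph n → Set
HasCycle {n} G = Σ (Fin n) λ x → Σ (Fin n) λ y → Σ (Fin n) λ z → Σ (List (Fin n)) λ rest →
  Unique (x ∷ y ∷ z ∷ rest) × Chain G (x ∷ y ∷ z ∷ rest) × Adj G (L⁺.last (z L⁺.∷ rest)) x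

IsTree : ∀ {n} → Graph n → Set
IsTree G = Connected G × ¬ HasCycle G

IsSubtreeAt : ∀ {n} → Graph n → Fin n → Subset n → Set
IsSubtreeAt G r S = r ∈ₛ S × (∀ u v → u ∈ₛ S → v ∈ₛ S → WalkIn G S u v)

-- average s / k (the count k is never 0 in our use)
mean : ℕ → ℕ → ℚ
mean s zero    = 0ℚ
mean s (suc k) = (+ s) / suc k

LocalMean : ∀ {n} → Graph n → Fin n → ℚ → Set
LocalMean {n} G r q = Σ (List (Subset n)) λ L →
  Unique L × (∀ S → (S ∈ˡ L) ⇔ IsSubtreeAt G r S) × q ≡ mean (sum (map ∣_∣ L)) (length L)

data Consec {n} : List (Fin n) → Fin n → Fin n → Set where
  now   : ∀ {x y xs} → Consec (x ∷ y ∷ xs) x y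
  later : ∀ {z xs x y} → Consec xs x y → Consec (z ∷ xs) x y

-- G is a broom: a path r = p₀, p₁, …, p_k = e (distinct vertices) with every
-- other vertex a leaf attached to e; and r is the end of the path opposite e.
IsBroomFrom : ∀ {n} → Graph n → Fin n → Set
IsBroomFrom {n} G r = Σ (List (Fin n)) λ ps →
  Unique (r ∷ ps) ×
  (∀ u v → Adj G u v ⇔
     (Consec (r ∷ ps) u v ⊎ Consec (r ∷ ps) v u
      ⊎ (u ≡ L⁺.last (r L⁺.∷ ps) × v ∉ˡ (r ∷ ps))
      ⊎ (v ≡ L⁺.last (r L⁺.∷ ps) × u ∉ˡ (r ∷ ps))))

{-# OPTIONS --safe #-}

-- Write (N , S) for the number and the total size of the subtrees containing the
-- root, F = S / N for the maximal mean, and let v be the first vertex on the way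
-- down from the root r, at depth k, that has several children, not all of them
-- leaves.  A change of the tree that adds or deletes sets compares the mean of
-- these sets with F.  Take branches B₁, B₂ at v, not both single vertices, with
-- local means μ₁ ≥ μ₂, and let c be the mean contributed by v and the remaining
-- branches.
-- * Hanging B₂ from the root of B₁ deletes sets of mean k + c + μ₂, so F ≤ k + c + μ₂.
-- * If k > 0, cutting r off and hanging it as a leaf from v gives
--   W ≤ (F - k)(M - 1), where M and W are the number and the total size (not
--   counting v) of the subtrees at v; if k = 0, then F = 1 + W / M.
-- The two are incompatible unless B₁ is a path with two vertices; in that case
-- hanging its leaf directly from v adds sets of mean larger than F.
-- So all branches at v are leaves, and the tree is a broom.

module Submission where

open import Defs
open import Data.Nat using (ℕ; zero; suc; pred; _+_; _*_; _≤_; _<_; z≤n; s≤s; >-nonZero)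
open import Data.Nat.Properties
open import Data.Nat.Tactic.RingSolver using (solve-∀)
open import Data.Bool using (true; _∨_)
open import Data.Bool.Properties using (∨-comm)
open import Data.Fin using (Fin; zero; suc)
import Data.Fin.Properties as Finₚ
open import Data.Fin.Subset using (Subset; inside; outside; ∣_∣) renaming (_∈_ to _∈ₛ_; ⊥ to ⊥ₛ)
open import Data.Fin.Subset.Properties using (∈⊤; ∉⊥; ⊆-antisym; _∈?_; ∣⊥∣≡0)
import Data.Integer as ℤ
import Data.Integer.Properties as ℤₚ
open import Data.List using (List; []; _∷_; _++_; _∷ʳ_; length; map; allFin; cartesianProductWith; initLast; _∷ʳ′_)
import Data.List.NonEmpty as L⁺
import Data.List.Properties as Listₚ
open import Data.List.Properties using (++-identityʳ)
open import Data.List.Membership.Propositional using (_∈_; _∉_)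
open import Data.List.Membership.Propositional.Properties using (∈-++⁺ˡ; ∈-++⁺ʳ; ∈-++⁻; ∈-allFin; ∈-map⁺; ∈-map⁻; ∈-cartesianProductWith⁺; ∈-cartesianProductWith⁻)
open import Data.List.Membership.DecPropositional using () renaming (_∈?_ to mem?)
open import Data.List.Relation.Binary.Disjoint.Propositional using (Disjoint)
open import Data.List.Relation.Binary.Permutation.Propositional using (_↭_; prep; ↭-refl; ↭-reflexive; ↭-sym; ↭-trans; swap; ↭⇒↭ₛ; module PermutationReasoning)
open import Data.List.Relation.Binary.Permutation.Propositional.Properties using (shift; shifts; ++⁺ˡ; ++⁺ʳ; ++⁺; ∈-resp-↭)
import Data.List.Relation.Binary.Permutation.Setoid.Properties as ↭ₛ
open import Data.List.Relation.Unary.All as All using (All; []; _∷_)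
import Data.List.Relation.Unary.All.Properties as Allₚ
open import Data.List.Relation.Unary.AllPairs using ([]; _∷_)
import Data.List.Relation.Unary.Any as Any
open import Data.List.Relation.Unary.Unique.Propositional using (Unique)
import Data.List.Relation.Unary.Unique.Propositional.Properties as Uniqueₚ
open import Data.Nat.ListAction using (sum)
open import Data.Nat.ListAction.Properties using (sum-++)
open import Data.Product using (Σ; ∃; _×_; _,_; proj₁; proj₂)
open import Data.Rational using (ℚ) renaming (_≤_ to _≤ℚ_)
import Data.Rational.Properties as ℚₚ
open import Data.Rational.Unnormalised using (mkℚᵘ; *≤*)
import Data.Rational.Unnormalised.Properties as ℚᵘₚ
open import Data.Sum using (_⊎_; inj₁; inj₂; [_,_]′)
open import Data.Empty using (⊥; ⊥-elim)
open import Data.Vec using (_[_]≔_; []; _∷_; here; there)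
open import Data.Vec.Properties using ([]≔-updates; []≔-minimal; lookup⇒[]=; []=⇒lookup; lookup∘update′)
open import Function.Construct.Composition using (_⇔-∘_)
open import Function using (_∘_; mk⇔; Equivalence; _⇔_)
open import Relation.Nullary using (¬_; Dec; yes; no; does)
open import Relation.Nullary.Decidable using (_⊎-dec_; _×-dec_; map′; dec-true; dec-false)
open import Relation.Binary.PropositionalEquality renaming (sym to ≡-sym)

pattern hd = Any.here refl
pattern tl i = Any.there i

-- Rooted forests and their parent-closed sets.

-- First-child and next-sibling encoding. The root stays outside: a tree is a root `r` together with
-- the forest of its branches.
data Forest (A : Set) : Set where
  ∅    : Forest A
  node : (a : A) (children siblings : Forest A) → Forest A

private
  variable
    A : Set

labels : Forest A → List A
labels ∅            = []
labels (node a c s) = a ∷ labels c ++ labels s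

size : Forest A → ℕ
size ∅            = 0
size (node a c s) = suc (size c + size s)

-- Number and total size of the sets of vertices of a forest that contain,
-- with every vertex, its parent.
count total : Forest A → ℕ
count ∅            = 1
count (node a c s) = suc (count c) * count s
total ∅            = 0
total (node a c s) = (count c + total c) * count s + suc (count c) * total s

-- The common root enlarges each of the `count f` sets by one. Hence `treeTotal f` over `count f` is
-- the local mean at the root of the tree with branches `f`.
treeTotal : Forest A → ℕ
treeTotal f = count f + total f

-- The empty set and, for each vertex, the vertex with all its ancestors are distinct closed sets.
size<count : (f : Forest A) → size f < count f
size<count ∅ = s≤s z≤n
size<count (node a c s) = begin
  suc (suc (size c + size s))          ≡⟨ +-comm 1 _ ⟩
  suc (size c) + size s + 1            ≤⟨ m≤m+n _ _ ⟩
  suc (size c) + size s + 1 + suc (size c) * size s ≡⟨ eq (size c) (size s) ⟩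
  suc (suc (size c)) * suc (size s)    ≤⟨ *-mono-≤ (s≤s (size<count c)) (size<count s) ⟩
  suc (count c) * count s ∎
  where
  open ≤-Reasoning
  eq : ∀ c s → suc c + s + 1 + suc c * s ≡ suc (suc c) * suc s
  eq = solve-∀

count-positive : (f : Forest A) → 1 ≤ count f
count-positive f = ≤-trans (s≤s z≤n) (size<count f)

-- In the tree at `a` only one closed set omits `a`. The `suc m` vertices that it misses are made up
-- for by `a` lying in the other `p` sets, since `suc m ≤ p`. So a closed set contains on average at
-- least half of the vertices.
size*count≤2*total : (f : Forest A) → size f * count f ≤ 2 * total f
size*count≤2*total ∅ = z≤n
size*count≤2*total (node a c s) = begin
  suc (m + n) * (suc p * q)
    ≡⟨ eq₁ m n p q ⟩
  (p + m * p + suc m) * q + suc p * (n * q)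
    ≤⟨ +-mono-≤ (*-monoˡ-≤ q (+-mono-≤ (+-monoʳ-≤ p (size*count≤2*total c)) (size<count c)))
                (*-monoʳ-≤ (suc p) (size*count≤2*total s)) ⟩
  (p + 2 * total c + p) * q + suc p * (2 * total s)
    ≡⟨ eq₂ p q (total c) (total s) ⟩
  2 * total (node a c s) ∎
  where
  open ≤-Reasoning
  m = size c
  n = size s
  p = count c
  q = count s
  eq₁ : ∀ m n p q → suc (m + n) * (suc p * q) ≡ (p + m * p + suc m) * q + suc p * (n * q)
  eq₁ = solve-∀
  eq₂ : ∀ p q v w → (p + 2 * v + p) * q + suc p * (2 * w) ≡ 2 * ((p + v) * q + suc p * w)
  eq₂ = solve-∀

-- The index is the forest below the top vertex of a branch. Of a branch with at least three
-- vertices, the inequalities use only that it has at least three subtrees at its top, of mean at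
-- least two.
data BranchKind {A : Set} : Forest A → Set where
  leaf : BranchKind ∅
  edge : ∀ b → BranchKind (node b ∅ ∅)
  big  : ∀ {c} → 3 ≤ count c → 2 * count c ≤ treeTotal c → BranchKind c

big-branch : (c : Forest A) → 2 ≤ size c → BranchKind c
big-branch c 2≤size = big (≤-trans (s≤s 2≤size) (size<count c)) (begin
  2 * count c         ≡⟨ cong (count c +_) (+-identityʳ _) ⟩
  count c + count c   ≤⟨ +-monoʳ-≤ (count c) (*-cancelˡ-≤ 2 2count≤2total) ⟩
  treeTotal c         ∎)
  where
  open ≤-Reasoning
  2count≤2total : 2 * count c ≤ 2 * total c
  2count≤2total = ≤-trans (*-monoˡ-≤ (count c) 2≤size) (size*count≤2*total c)

branchKind : (c : Forest A) → BranchKind c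
branchKind ∅                         = leaf
branchKind (node b ∅ ∅)              = edge b
branchKind c@(node _ (node _ _ _) _) = big-branch c (s≤s (s≤s z≤n))
branchKind c@(node _ ∅ (node _ _ _)) = big-branch c (s≤s (s≤s z≤n))

-- Below a root, `length ps` is the depth of the vertex that carries `g`.
prepend : List A → Forest A → Forest A
prepend []       g = g
prepend (a ∷ ps) g = node a (prepend ps g) ∅

labels-prepend : (ps : List A) (g : Forest A) → labels (prepend ps g) ≡ ps ++ labels g
labels-prepend []       g = refl
labels-prepend (a ∷ ps) g = cong (a ∷_) (trans (++-identityʳ _) (labels-prepend ps g))

triangle : ℕ → ℕ
triangle zero    = 0
triangle (suc k) = suc k + triangle k

count-prepend : (ps : List A) (g : Forest A) → count (prepend ps g) ≡ length ps + count g
count-prepend []       g = refl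
count-prepend (a ∷ ps) g = cong suc (trans (*-identityʳ _) (count-prepend ps g))

-- The sets that end above the vertex carrying `g` have the sizes from 1 to `length ps`. Every other
-- set consists of the `length ps` vertices above it and a subtree at this vertex.
treeTotal-prepend : (ps : List A) (g : Forest A) →
  treeTotal (prepend ps g) ≡ triangle (length ps) + (length ps * count g + treeTotal g)
treeTotal-prepend []       g = refl
treeTotal-prepend (a ∷ ps) g = begin
  suc (count f * 1) + (treeTotal f * 1 + suc (count f) * 0)
    ≡⟨ eq₁ (count f) (treeTotal f) ⟩
  suc (count f) + treeTotal f
    ≡⟨ cong₂ (λ p w → suc p + w) (count-prepend ps g) (treeTotal-prepend ps g) ⟩
  suc (k + count g) + (triangle k + (k * count g + treeTotal g))
    ≡⟨ eq₂ k (count g) (triangle k) (treeTotal g) ⟩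
  triangle (suc k) + (suc k * count g + treeTotal g) ∎
  where
  open ≡-Reasoning
  k = length ps
  f = prepend ps g
  eq₁ : ∀ p w → suc (p * 1) + (w * 1 + suc p * 0) ≡ suc p + w
  eq₁ = solve-∀
  eq₂ : ∀ k p t w → suc (k + p) + (t + (k * p + w)) ≡ suc k + t + (suc k * p + w)
  eq₂ = solve-∀

-- Comparison of neighbouring trees

-- Means are compared by cross multiplication. The permutation makes each competitor a tree on the
-- same vertices, possibly with another root.
Maximal : A → Forest A → Set
Maximal {A} r f = (r′ : A) (f′ : Forest A) → r′ ∷ labels f′ ↭ r ∷ labels f →
  treeTotal f′ * count f ≤ treeTotal f * count f′

-- Deleting sets from (resp. adding sets to) a family does not increase the
-- mean only if the mean of these sets is at least (resp. at most) the old mean.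
deleted-mean : ∀ S S′ {N N′} L ℓ → N ≡ N′ + ℓ → S ≡ S′ + L → S′ * N ≤ S * N′ → S * ℓ ≤ L * N
deleted-mean S S′ {N} {N′} L ℓ N≡ S≡ le = +-cancelˡ-≤ (S * N′) _ _ (begin
  S * N′ + S * ℓ  ≡⟨ *-distribˡ-+ S N′ ℓ ⟨
  S * (N′ + ℓ)    ≡⟨ cong₂ _*_ S≡ (≡-sym N≡) ⟩
  (S′ + L) * N    ≡⟨ *-distribʳ-+ N S′ L ⟩
  S′ * N + L * N  ≤⟨ +-monoˡ-≤ (L * N) le ⟩
  S * N′ + L * N  ∎)
  where open ≤-Reasoning

added-mean : ∀ S S′ {N N′} L ℓ → N′ ≡ N + ℓ → S′ ≡ S + L → S′ * N ≤ S * N′ → L * N ≤ S * ℓ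
added-mean S S′ {N} {N′} L ℓ N≡ S≡ le = +-cancelˡ-≤ (S * N) _ _ (begin
  S * N + L * N  ≡⟨ *-distribʳ-+ N S L ⟨
  (S + L) * N    ≡⟨ cong (_* N) S≡ ⟨
  S′ * N         ≤⟨ le ⟩
  S * N′         ≡⟨ cong (S *_) N≡ ⟩
  S * (N + ℓ)    ≡⟨ *-distribˡ-+ S N ℓ ⟩
  S * N + S * ℓ  ∎)
  where open ≤-Reasoning

module Branches (r : A) (ps : List A) (x : A) (c : Forest A) (y : A) (d h : Forest A)
  (max : Maximal r (prepend ps (node x c (node y d h)))) where

  k = length ps
  t = node y d h
  g = node x c t
  N = count (prepend ps g)
  S = treeTotal (prepend ps g)
  ℓ = count d * count h
  X = treeTotal d * count h + count d * total h + ℓ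

  -- Hanging the branch at `y` below `x` deletes exactly the sets that contain `y` but not `x`.
  -- There are `ℓ` of them, and `X` is their total size without the `k` vertices above the branching
  -- vertex.
  move-branch : S * ℓ ≤ (X + k * ℓ) * N
  move-branch = deleted-mean S (treeTotal (prepend ps g′)) (X + k * ℓ) ℓ N≡ S≡ (max r (prepend ps g′) labels≡)
    where
    g′ = node x (node y d c) h
    labels≡ : r ∷ labels (prepend ps g′) ↭ r ∷ labels (prepend ps g)
    labels≡ = prep r (begin
      labels (prepend ps g′)  ≡⟨ labels-prepend ps g′ ⟩
      ps ++ labels g′         ↭⟨ ++⁺ˡ ps (prep x (begin
         (y ∷ labels d ++ labels c) ++ labels h   ≡⟨ Listₚ.++-assoc (y ∷ labels d) (labels c) (labels h) ⟩
         (y ∷ labels d) ++ labels c ++ labels h   ↭⟨ shifts (y ∷ labels d) (labels c) ⟩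
         labels c ++ (y ∷ labels d) ++ labels h   ∎)) ⟩
      ps ++ labels g          ≡⟨ labels-prepend ps g ⟨
      labels (prepend ps g)   ∎)
      where open PermutationReasoning
    open ≡-Reasoning
    N≡ : N ≡ count (prepend ps g′) + ℓ
    N≡ = begin
      N                              ≡⟨ count-prepend ps g ⟩
      k + count g                    ≡⟨ eq k (count c) (count d) (count h) ⟩
      k + count g′ + ℓ               ≡⟨ cong (_+ ℓ) (count-prepend ps g′) ⟨
      count (prepend ps g′) + ℓ      ∎
      where
      eq : ∀ k c d h → k + suc c * (suc d * h) ≡ k + suc (suc d * c) * h + d * h
      eq = solve-∀
    S≡ : S ≡ treeTotal (prepend ps g′) + (X + k * ℓ)
    S≡ = begin
      S ≡⟨ treeTotal-prepend ps g ⟩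
      _ ≡⟨ eq (triangle k) k (count c) (count d) (count h) (total c) (total d) (total h) ⟩
      _ ≡⟨ cong (_+ (X + k * ℓ)) (treeTotal-prepend ps g′) ⟨
      treeTotal (prepend ps g′) + (X + k * ℓ) ∎
      where
      eq : ∀ t k c d h c′ d′ h′ →
        t + (k * (suc c * (suc d * h)) + (suc c * (suc d * h) +
          ((c + c′) * (suc d * h) + suc c * ((d + d′) * h + suc d * h′))))
        ≡ t + (k * (suc (suc d * c) * h) + (suc (suc d * c) * h +
          ((suc d * c + ((d + d′) * c + suc d * c′)) * h + suc (suc d * c) * h′)))
          + ((d + d′) * h + d * h′ + d * h + k * (d * h))
      eq = solve-∀

  1≤ℓ : 1 ≤ ℓ
  1≤ℓ = *-mono-≤ (count-positive d) (count-positive h)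

  -- With gᵢ and μᵢ the mean sizes of the closed sets of the i-th branch with and
  -- without the empty set, this says g₁ + g₂ ≥ μ₂ + 1, cleared of denominators.
  Dominates : Set
  Dominates = suc (count c) * treeTotal d + suc (count c) * suc (count d) * count d
           ≤ treeTotal c * count d * suc (count d)

  -- Choices in different branches are independent, so means add: `X / ℓ` is 1 + μ₂ and the mean of
  -- `h`, while `total g / count g` is g₁ + g₂ and the mean of `h`.
  dominates⇒ : Dominates → count g * X ≤ ℓ * total g
  dominates⇒ le = begin
    count g * X
      ≡⟨ eq₁ (count c) (count d) (treeTotal d) (count h) (total h) ⟩
    count h * (count h * (suc (count c) * treeTotal d + suc (count c) * suc (count d) * count d)) + rest
      ≤⟨ +-monoˡ-≤ rest (*-monoʳ-≤ (count h) (*-monoʳ-≤ (count h) le)) ⟩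
    count h * (count h * (treeTotal c * count d * suc (count d))) + rest
      ≡⟨ eq₂ (count c) (count d) (treeTotal c) (treeTotal d) (count h) (total h) ⟩
    ℓ * total g ∎
    where
    open ≤-Reasoning
    -- What both sides share: the contribution of `h`, and the part of μ₂ that g₂ also has.
    rest = count h * (suc (count c) * count d * treeTotal d * count h + suc (count c) * suc (count d) * count d * total h)
    eq₁ : ∀ c d d′ h h′ → suc c * (suc d * h) * (d′ * h + d * h′ + d * h) ≡
      h * (h * (suc c * d′ + suc c * suc d * d)) + h * (suc c * d * d′ * h + suc c * suc d * d * h′)
    eq₁ = solve-∀
    eq₂ : ∀ c d c′ d′ h h′ → h * (h * (c′ * d * suc d)) + h * (suc c * d * d′ * h + suc c * suc d * d * h′)
      ≡ d * h * (c′ * (suc d * h) + suc c * (d′ * h + suc d * h′))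
    eq₂ = solve-∀

-- Cutting the root r off and hanging it as a leaf below the branching vertex,
-- so that the next vertex of the path becomes the root.
move-root : (r a : A) (ps : List A) (g : Forest A) (m : ℕ) → count g ≡ suc m →
  Maximal r (prepend (a ∷ ps) g) →
  (total g + suc (length ps) * m) * count (prepend (a ∷ ps) g) ≤ treeTotal (prepend (a ∷ ps) g) * m
move-root r a ps g m M≡ max =
  -- Old sets that reach the branching vertex reappear with `r` as a leaf, and old sets that end
  -- above it have counterparts among the bare paths. New are the `m` sets that avoid `r` and
  -- contain a vertex below the branching vertex.
  added-mean (treeTotal f) (treeTotal f′) (total g + suc k * m) m N≡ S≡ (max a f′ labels≡)
  where
  k = length ps
  g′ = node r ∅ g
  f = prepend (a ∷ ps) g
  f′ = prepend ps g′
  labels≡ : a ∷ labels f′ ↭ r ∷ labels f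
  labels≡ = begin
    a ∷ labels f′              ≡⟨ cong (a ∷_) (labels-prepend ps g′) ⟩
    (a ∷ ps) ++ r ∷ labels g   ↭⟨ shift r (a ∷ ps) (labels g) ⟩
    r ∷ (a ∷ ps) ++ labels g   ≡⟨ cong (r ∷_) (labels-prepend (a ∷ ps) g) ⟨
    r ∷ labels f               ∎
    where open PermutationReasoning
  open ≡-Reasoning
  N≡ : count f′ ≡ count f + m
  N≡ = begin
    count f′                ≡⟨ count-prepend ps g′ ⟩
    k + 2 * count g         ≡⟨ cong (λ M → k + 2 * M) M≡ ⟩
    k + 2 * suc m           ≡⟨ eq k m ⟩
    suc (k + suc m) + m     ≡⟨ cong (λ M → suc (k + M) + m) M≡ ⟨
    suc (k + count g) + m   ≡⟨ cong (_+ m) (count-prepend (a ∷ ps) g) ⟨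
    count f + m             ∎
    where
    eq : ∀ k m → k + 2 * suc m ≡ suc (k + suc m) + m
    eq = solve-∀
  S≡ : treeTotal f′ ≡ treeTotal f + (total g + suc k * m)
  S≡ = begin
    treeTotal f′
      ≡⟨ treeTotal-prepend ps g′ ⟩
    triangle k + (k * (2 * count g) + (2 * count g + (1 * count g + 2 * total g)))
      ≡⟨ cong (λ M → triangle k + (k * (2 * M) + (2 * M + (1 * M + 2 * total g)))) M≡ ⟩
    triangle k + (k * (2 * suc m) + (2 * suc m + (1 * suc m + 2 * total g)))
      ≡⟨ eq (triangle k) k m (total g) ⟩
    triangle (suc k) + (suc k * suc m + (suc m + total g)) + (total g + suc k * m)
      ≡⟨ cong (λ M → triangle (suc k) + (suc k * M + (M + total g)) + (total g + suc k * m)) M≡ ⟨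
    triangle (suc k) + (suc k * count g + (count g + total g)) + (total g + suc k * m)
      ≡⟨ cong (_+ (total g + suc k * m)) (treeTotal-prepend (a ∷ ps) g) ⟨
    treeTotal f + (total g + suc k * m) ∎
    where
    eq : ∀ t k m w → t + (k * (2 * suc m) + (2 * suc m + (1 * suc m + 2 * w)))
      ≡ suc k + t + (suc k * suc m + (suc m + w)) + (w + suc k * m)
    eq = solve-∀

-- Eliminates the maximal mean `S / N` between an upper and a lower bound for it.
combine : ∀ {a b N} S P Q → 1 ≤ N → S * a ≤ P * N → Q * N ≤ S * b → Q * a ≤ P * b
combine {a} {b} {N} S P Q 1≤N SaPN QNSb = *-cancelˡ-≤ N {{>-nonZero 1≤N}} (begin
  N * (Q * a)  ≡⟨ eq₁ N Q a ⟩
  Q * N * a    ≤⟨ *-monoˡ-≤ a QNSb ⟩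
  S * b * a    ≡⟨ eq₂ S b a ⟩
  S * a * b    ≤⟨ *-monoˡ-≤ b SaPN ⟩
  P * N * b    ≡⟨ eq₁ N P b ⟨
  N * (P * b)  ∎)
  where
  open ≤-Reasoning
  eq₁ : ∀ n q a → n * (q * a) ≡ q * n * a
  eq₁ = solve-∀
  eq₂ : ∀ s b a → s * b * a ≡ s * a * b
  eq₂ = solve-∀

-- Dominance bounds `X / ℓ` by `total g / count g`. At depth 0 this is the maximal mean minus 1, but
-- `move-branch` makes `X / ℓ` at least that mean. At positive depth, `move-root` and `move-branch`
-- give `total g / m ≤ X / ℓ` with `m` one less than `count g`, again too much.
dominates-impossible : (r : A) (ps : List A) (x : A) (c : Forest A) (y : A) (d h : Forest A)
  (max : Maximal r (prepend ps (node x c (node y d h)))) →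
  ¬ Branches.Dominates r ps x c y d h max
dominates-impossible r [] x c y d h max dominates = <-irrefl refl (begin-strict
  ℓ * total g                        <⟨ m<n+m (ℓ * total g) (*-mono-≤ (count-positive g) 1≤ℓ) ⟩
  count g * ℓ + ℓ * total g          ≡⟨ eq (count g) ℓ (total g) ⟩
  treeTotal g * ℓ                    ≤⟨ move-branch ⟩
  (X + 0 * ℓ) * count g              ≡⟨ cong (_* count g) (+-identityʳ X) ⟩
  X * count g                        ≡⟨ *-comm X (count g) ⟩
  count g * X                        ≤⟨ dominates⇒ dominates ⟩
  ℓ * total g                        ∎)
  where
  open Branches r [] x c y d h max
  open ≤-Reasoning
  eq : ∀ p ℓ w → p * ℓ + ℓ * w ≡ (p + w) * ℓ
  eq = solve-∀
dominates-impossible r (a ∷ ps) x c y d h max dominates = <-irrefl refl (begin-strict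
  m * X          <⟨ *-monoˡ-< X {{>-nonZero (≤-trans 1≤ℓ (m≤n+m ℓ _))}} (n<1+n m) ⟩
  suc m * X      ≡⟨ cong (_* X) M≡ ⟨
  count g * X    ≤⟨ dominates⇒ dominates ⟩
  ℓ * total g    ≤⟨ +-cancelʳ-≤ (k * m * ℓ) _ _ cancelled ⟩
  m * X          ∎)
  where
  open Branches r (a ∷ ps) x c y d h max
  open ≤-Reasoning
  m = pred (count g)
  M≡ : count g ≡ suc m
  M≡ = ≡-sym (suc-pred (count g) {{>-nonZero (count-positive g)}})
  eq₁ : ∀ w k m ℓ → ℓ * w + k * m * ℓ ≡ (w + k * m) * ℓ
  eq₁ = solve-∀
  eq₂ : ∀ x k m ℓ → (x + k * ℓ) * m ≡ m * x + k * m * ℓ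
  eq₂ = solve-∀
  cancelled : ℓ * total g + k * m * ℓ ≤ m * X + k * m * ℓ
  cancelled = begin
    ℓ * total g + k * m * ℓ   ≡⟨ eq₁ (total g) k m ℓ ⟩
    (total g + k * m) * ℓ     ≤⟨ combine S (X + k * ℓ) (total g + k * m) (count-positive (prepend (a ∷ ps) g))
                                   move-branch (move-root r a ps g m M≡ max) ⟩
    (X + k * ℓ) * m           ≡⟨ eq₂ X k m ℓ ⟩
    m * X + k * m * ℓ         ∎

-- With q = `count d`, the sum g₁ + g₂ - μ₂ equals μ₁ c/(c+1) - μ₂/(q+1), and the first term is at
-- least 2 · 3/4. For a vertex or an edge the second term is 1/2. Otherwise μ₂ ≤ μ₁ and q ≥ 3 leave
-- at least μ₁ (3/4 - 1/4) ≥ 1.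
dominates : ∀ c c′ (d : Forest A) → 3 ≤ c → 2 * c ≤ c′ → treeTotal d * c ≤ c′ * count d →
  suc c * treeTotal d + suc c * suc (count d) * count d ≤ c′ * count d * suc (count d)
dominates c c′ d 3≤c 2c≤c′ le with branchKind d
... | leaf = begin
  suc c * 1 + suc c * 2 * 1   ≡⟨ eq₁ c ⟩
  3 + 3 * c                   ≤⟨ +-monoˡ-≤ (3 * c) 3≤c ⟩
  c + 3 * c                   ≡⟨ eq₂ c ⟩
  2 * c * 2                   ≤⟨ *-monoˡ-≤ 2 2c≤c′ ⟩
  c′ * 2                      ≡⟨ cong (_* 2) (*-identityʳ c′) ⟨
  c′ * 1 * 2                  ∎
  where
  open ≤-Reasoning
  eq₁ : ∀ c → suc c * 1 + suc c * 2 * 1 ≡ 3 + 3 * c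
  eq₁ = solve-∀
  eq₂ : ∀ c → c + 3 * c ≡ 2 * c * 2
  eq₂ = solve-∀
... | edge _ = begin
  suc c * 3 + suc c * 3 * 2   ≡⟨ eq₁ c ⟩
  3 * 3 + 9 * c               ≤⟨ +-monoˡ-≤ (9 * c) (*-monoʳ-≤ 3 3≤c) ⟩
  3 * c + 9 * c               ≡⟨ eq₂ c ⟩
  2 * c * 2 * 3               ≤⟨ *-monoˡ-≤ 3 (*-monoˡ-≤ 2 2c≤c′) ⟩
  c′ * 2 * 3                  ∎
  where
  open ≤-Reasoning
  eq₁ : ∀ c → suc c * 3 + suc c * 3 * 2 ≡ 3 * 3 + 9 * c
  eq₁ = solve-∀
  eq₂ : ∀ c → 3 * c + 9 * c ≡ 2 * c * 2 * 3
  eq₂ = solve-∀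
... | big 3≤d _ with m≤n⇒∃[o]m+o≡n 3≤c | m≤n⇒∃[o]m+o≡n 3≤d | m≤n⇒∃[o]m+o≡n 2c≤c′
...   | i , refl | j , d≡ | t , refl = *-cancelˡ-≤ c (begin
  c * (suc c * d′ + suc c * suc D * D)                   ≡⟨ eq₁ c D d′ ⟩
  suc c * (d′ * c) + c * suc c * suc D * D               ≤⟨ +-monoˡ-≤ _ (*-monoʳ-≤ (suc c) le) ⟩
  suc c * (c′ * D) + c * suc c * suc D * D               ≤⟨ m≤m+n _ (gap D) ⟩
  suc c * (c′ * D) + c * suc c * suc D * D + gap D       ≡⟨ cong (λ D → suc c * (c′ * D) + c * suc c * suc D * D + gap D) d≡ ⟨
  _                                                      ≡⟨ eq₂ i j t ⟩
  c * (c′ * (3 + j) * suc (3 + j))                       ≡⟨ cong (λ D → c * (c′ * D * suc D)) d≡ ⟩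
  c * (c′ * D * suc D)                                   ∎)
  where
  open ≤-Reasoning
  D = count d
  d′ = treeTotal d
  -- The surplus after substituting `c = 3 + i`, `D = 3 + j` and `c′ = 2 * c + t`; all its
  -- coefficients are nonnegative.
  gap : ℕ → ℕ
  gap D = D * (c * (2 * i + 2 * j + i * j) + t * (8 + 3 * i + 3 * j + i * j))
  eq₁ : ∀ c d d′ → c * (suc c * d′ + suc c * suc d * d) ≡ suc c * (d′ * c) + c * suc c * suc d * d
  eq₁ = solve-∀
  eq₂ : ∀ i j t →
    suc (3 + i) * ((2 * (3 + i) + t) * (3 + j)) + (3 + i) * suc (3 + i) * suc (3 + j) * (3 + j)
      + (3 + j) * ((3 + i) * (2 * i + 2 * j + i * j) + t * (8 + 3 * i + 3 * j + i * j))
    ≡ (3 + i) * ((2 * (3 + i) + t) * (3 + j) * suc (3 + j))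
  eq₂ = solve-∀

-- Making `z` a sibling of `x` adds the sets that contain `z` but not `x`; the summand `2 * count t`
-- counts the branching vertex and `z` in each.
raise-leaf : (r : A) (ps : List A) (x z : A) (t : Forest A) →
  let f = prepend ps (node x (node z ∅ ∅) t) in
  Maximal r f → (2 * count t + total t + length ps * count t) * count f ≤ treeTotal f * count t
raise-leaf r ps x z t max =
  added-mean (treeTotal f) (treeTotal f′) _ (count t) N≡ S≡ (max r f′ labels≡)
  where
  k = length ps
  g = node x (node z ∅ ∅) t
  g′ = node x ∅ (node z ∅ t)
  f = prepend ps g
  f′ = prepend ps g′
  labels≡ : r ∷ labels f′ ↭ r ∷ labels f
  labels≡ = ↭-reflexive (cong (r ∷_) (trans (labels-prepend ps g′) (≡-sym (labels-prepend ps g))))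
  open ≡-Reasoning
  N≡ : count f′ ≡ count f + count t
  N≡ = begin
    count f′                ≡⟨ count-prepend ps g′ ⟩
    k + count g′            ≡⟨ eq k (count t) ⟩
    k + count g + count t   ≡⟨ cong (_+ count t) (count-prepend ps g) ⟨
    count f + count t       ∎
    where
    eq : ∀ k q → k + 2 * (2 * q) ≡ k + 3 * q + q
    eq = solve-∀
  S≡ : treeTotal f′ ≡ treeTotal f + (2 * count t + total t + k * count t)
  S≡ = begin
    treeTotal f′   ≡⟨ treeTotal-prepend ps g′ ⟩
    _              ≡⟨ eq (triangle k) k (count t) (total t) ⟩
    _              ≡⟨ cong (_+ (2 * count t + total t + k * count t)) (treeTotal-prepend ps g) ⟨
    treeTotal f + (2 * count t + total t + k * count t) ∎
    where
    eq : ∀ t k q u →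
      t + (k * (2 * (2 * q)) + (2 * (2 * q) + (1 * (2 * q) + 2 * (1 * q + 2 * u))))
      ≡ t + (k * (3 * q) + (3 * q + (3 * q + 3 * u))) + (2 * q + u + k * q)
    eq = solve-∀

-- Raising the leaf z contradicts moving the branch at y below x.
two-path-impossible : (r : A) (ps : List A) (x z y : A) (d h : Forest A) →
  Maximal r (prepend ps (node x (node z ∅ ∅) (node y d h))) →
  treeTotal d * 2 ≤ 3 * count d → ⊥
two-path-impossible r ps x z y d h max le = case
  where
  open Branches r ps x (node z ∅ ∅) y d h max
  open ≤-Reasoning
  H = count h
  V = total h
  eq₁ : ∀ q u k l → (2 * q + u) * l + k * q * l ≡ (2 * q + u + k * q) * l
  eq₁ = solve-∀
  eq₂ : ∀ x k l q → (x + k * l) * q ≡ x * q + k * q * l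
  eq₂ = solve-∀
  bound : (2 * count t + total t) * ℓ ≤ X * count t
  bound = +-cancelʳ-≤ (k * count t * ℓ) _ _ (begin
    (2 * count t + total t) * ℓ + k * count t * ℓ
      ≡⟨ eq₁ (count t) (total t) k ℓ ⟩
    (2 * count t + total t + k * count t) * ℓ
      ≤⟨ combine S (X + k * ℓ) (2 * count t + total t + k * count t)
           (count-positive (prepend ps g)) move-branch (raise-leaf r ps x z t max) ⟩
    (X + k * ℓ) * count t
      ≡⟨ eq₂ X k ℓ (count t) ⟩
    X * count t + k * count t * ℓ ∎)
  excess : ∀ m → 1 ≤ m → (2 * count t + total t) * ℓ ≡ X * count t + m → ⊥
  excess m 1≤m eq = <⇒≱ (≤-trans (m<m+n (X * count t) 1≤m) (≤-reflexive (≡-sym eq))) bound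
  case : ⊥
  case with branchKind d
  -- After cancelling the mean of `h`, `bound` says 1 + g₂ ≤ μ₂. But 1 + g₂ is 3/2 against μ₂ = 1
  -- for a vertex, and 2 against 3/2 for an edge.
  ... | leaf = excess (H * H) (*-mono-≤ (count-positive h) (count-positive h)) (eq H V)
    where
    eq : ∀ h v → (2 * (2 * h) + (1 * h + 2 * v)) * (1 * h) ≡ (1 * h + 1 * v + 1 * h) * (2 * h) + h * h
    eq = solve-∀
  ... | edge _ = excess (3 * (H * H)) (*-mono-≤ {1} {3} (s≤s z≤n) (*-mono-≤ (count-positive h) (count-positive h))) (eq H V)
    where
    eq : ∀ h v → (2 * (3 * h) + (3 * h + 3 * v)) * (2 * h) ≡ (3 * h + 2 * v + 2 * h) * (3 * h) + 3 * (h * h)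
    eq = solve-∀
  -- Such a branch has mean at least 2, whereas `le` bounds it by 3/2, the mean of an edge.
  ... | big 3≤d 2d≤ = <-irrefl refl (begin-strict
    3 * count d               <⟨ *-monoˡ-< (count d) {{>-nonZero (count-positive d)}} {3} {4} (s≤s (s≤s (s≤s (s≤s z≤n)))) ⟩
    4 * count d               ≡⟨ eq (count d) ⟩
    2 * count d * 2           ≤⟨ *-monoˡ-≤ 2 2d≤ ⟩
    treeTotal d * 2           ≤⟨ le ⟩
    3 * count d               ∎)
    where
    eq : ∀ d → 4 * d ≡ 2 * d * 2
    eq = solve-∀

NonEmpty : Forest A → Set
NonEmpty f = 1 ≤ size f

-- Only a single vertex has local mean 1, so it cannot be the heavier branch next to a larger one.
leaf-lightest : (d : Forest A) → NonEmpty d → count d < treeTotal d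
leaf-lightest d 1≤d = m<m+n (count d) (*-cancelˡ-≤ 2 (begin
  2                 ≤⟨ ≤-trans (s≤s 1≤d) (size<count d) ⟩
  count d           ≡⟨ *-identityˡ (count d) ⟨
  1 * count d       ≤⟨ *-monoˡ-≤ (count d) 1≤d ⟩
  size d * count d  ≤⟨ size*count≤2*total d ⟩
  2 * total d       ∎))
  where open ≤-Reasoning

ordered-branches-impossible : (r : A) (ps : List A) (x : A) (c : Forest A) (y : A) (d h : Forest A) →
  Maximal r (prepend ps (node x c (node y d h))) → NonEmpty c ⊎ NonEmpty d →
  treeTotal d * count c ≤ treeTotal c * count d → ⊥
ordered-branches-impossible r ps x c y d h max nonEmpty le with branchKind c
... | leaf with nonEmpty
...   | inj₂ 1≤d = <⇒≱ (leaf-lightest d 1≤d) (subst₂ _≤_ (*-identityʳ _) (+-identityʳ _) le)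
ordered-branches-impossible r ps x c y d h max nonEmpty le
    | edge z = two-path-impossible r ps x z y d h max le
ordered-branches-impossible r ps x c y d h max nonEmpty le
    | big 3≤c 2c≤ = dominates-impossible r ps x c y d h max (dominates (count c) (treeTotal c) d 3≤c 2c≤ le)

-- Reordering siblings.

-- The order of siblings is an artefact of the encoding. This relation keeps exactly the data on
-- which `Maximal` depends.
record _≈_ (f g : Forest A) : Set where
  field
    labels-≈ : labels f ↭ labels g
    count-≈  : count f ≡ count g
    total-≈  : total f ≡ total g

open _≈_

≈-refl : {f : Forest A} → f ≈ f
≈-refl = record { labels-≈ = ↭-refl ; count-≈ = refl ; total-≈ = refl }

≈-trans : {f g h : Forest A} → f ≈ g → g ≈ h → f ≈ h
≈-trans p q = record
  { labels-≈ = ↭-trans (labels-≈ p) (labels-≈ q)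
  ; count-≈  = trans (count-≈ p) (count-≈ q)
  ; total-≈  = trans (total-≈ p) (total-≈ q)
  }

node-≈ : ∀ (a : A) {c c′ s s′} → c ≈ c′ → s ≈ s′ → node a c s ≈ node a c′ s′
node-≈ a p q = record
  { labels-≈ = prep a (++⁺ (labels-≈ p) (labels-≈ q))
  ; count-≈  = cong₂ (λ c s → suc c * s) (count-≈ p) (count-≈ q)
  ; total-≈  = cong₂ _+_
      (cong₂ _*_ (cong₂ _+_ (count-≈ p) (total-≈ p)) (count-≈ q))
      (cong₂ (λ c s → suc c * s) (count-≈ p) (total-≈ q))
  }

swap-≈ : ∀ (a : A) c (b : A) d s → node a c (node b d s) ≈ node b d (node a c s)
swap-≈ a c b d s = record
  { labels-≈ = shifts (a ∷ labels c) (b ∷ labels d)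
  ; count-≈  = eq₁ (count c) (count d) (count s)
  ; total-≈  = eq₂ (count c) (count d) (count s) (total c) (total d) (total s)
  }
  where
  eq₁ : ∀ c d s → suc c * (suc d * s) ≡ suc d * (suc c * s)
  eq₁ = solve-∀
  eq₂ : ∀ c d s c′ d′ s′ →
    (c + c′) * (suc d * s) + suc c * ((d + d′) * s + suc d * s′)
    ≡ (d + d′) * (suc c * s) + suc d * ((c + c′) * s + suc c * s′)
  eq₂ = solve-∀

prepend-≈ : ∀ (ps : List A) {g g′} → g ≈ g′ → prepend ps g ≈ prepend ps g′
prepend-≈ []       p = p
prepend-≈ (a ∷ ps) p = node-≈ a (prepend-≈ ps p) ≈-refl

Maximal-resp-≈ : ∀ (r : A) {f g} → f ≈ g → Maximal r f → Maximal r g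
Maximal-resp-≈ r {f} {g} p max r′ f′ labels≡ =
  subst₂ (λ N S → treeTotal f′ * N ≤ S * count f′) (count-≈ p) (cong₂ _+_ (count-≈ p) (total-≈ p))
    (max r′ f′ (↭-trans labels≡ (prep r (↭-sym (labels-≈ p)))))

branches-impossible : (r : A) (ps : List A) (x : A) (c : Forest A) (y : A) (d h : Forest A) →
  Maximal r (prepend ps (node x c (node y d h))) → NonEmpty c → ⊥
branches-impossible r ps x c y d h max 1≤c with ≤-total (treeTotal d * count c) (treeTotal c * count d)
... | inj₁ le = ordered-branches-impossible r ps x c y d h max (inj₁ 1≤c) le
... | inj₂ ge = ordered-branches-impossible r ps y d x c h
  (Maximal-resp-≈ r (prepend-≈ ps (swap-≈ x c y d h)) max) (inj₂ 1≤c) ge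

-- Descent to the branching vertex.

data Leaves {A : Set} : Forest A → Set where
  ∅    : Leaves ∅
  leaf : ∀ {a s} → Leaves s → Leaves (node a ∅ s)

-- In `multiple` a branch that is not a single vertex has been brought to the front and a second
-- branch exhibited, as `branches-impossible` expects.
data Shape {A : Set} (g : Forest A) : Set where
  leaves   : Leaves g → Shape g
  single   : ∀ x c → NonEmpty c → g ≡ node x c ∅ → Shape g
  multiple : ∀ x c y d h → NonEmpty c → g ≈ node x c (node y d h) → Shape g

shape : (g : Forest A) → Shape g
shape ∅ = leaves ∅
shape (node a c@(node _ _ _) ∅) = single a c (s≤s z≤n) refl
shape (node a c@(node _ _ _) (node b d h)) = multiple a c b d h (s≤s z≤n) ≈-refl
shape (node a ∅ s) with shape s
... | leaves l = leaves (leaf l)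
-- The leaf `a` serves as the second branch.
... | single x c 1≤c refl = multiple x c a ∅ ∅ 1≤c (swap-≈ a ∅ x c ∅)
... | multiple x c y d h 1≤c s≈ = multiple x c a ∅ (node y d h) 1≤c
  (≈-trans (node-≈ a ≈-refl s≈) (swap-≈ a ∅ x c (node y d h)))

prepend-∷ʳ : (ps : List A) (a : A) (g : Forest A) → prepend (ps ∷ʳ a) g ≡ prepend ps (node a g ∅)
prepend-∷ʳ []       a g = refl
prepend-∷ʳ (b ∷ ps) a g = cong (λ f → node b f ∅) (prepend-∷ʳ ps a g)

-- An only child is moved to the end of the path `ps`. At the first vertex with several children,
-- `branches-impossible` leaves only the case that all of them are leaves.
maximal⇒broom : (r : A) (ps : List A) (g : Forest A) → Maximal r (prepend ps g) →
  ∃ λ qs → ∃ λ l → Leaves l × prepend ps g ≡ prepend qs l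
maximal⇒broom r ps ∅ max = ps , ∅ , ∅ , refl
maximal⇒broom r ps (node a c ∅) max
  with maximal⇒broom r (ps ∷ʳ a) c (subst (Maximal r) (≡-sym (prepend-∷ʳ ps a c)) max)
... | qs , l , isLeaves , eq = qs , l , isLeaves , trans (≡-sym (prepend-∷ʳ ps a c)) eq
maximal⇒broom r ps g@(node _ _ (node _ _ _)) max with shape g
... | leaves l = ps , g , l , refl
... | multiple x c y d h 1≤c g≈ =
  ⊥-elim (branches-impossible r ps x c y d h (Maximal-resp-≈ r (prepend-≈ ps g≈) max) 1≤c)

-- Parent edges, cuts and acyclicity

unique-resp-↭ : {xs ys : List A} → xs ↭ ys → Unique xs → Unique ys
unique-resp-↭ p = ↭ₛ.Unique-resp-↭ (setoid _) (↭⇒↭ₛ p)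

unique-++⁻ : (xs : List A) {ys : List A} → Unique (xs ++ ys) → Unique xs × Unique ys × Disjoint xs ys
unique-++⁻ [] u = [] , u , λ { (() , _) }
unique-++⁻ (x ∷ xs) (x∉ ∷ u) with unique-++⁻ xs u
... | uxs , uys , disj = Allₚ.++⁻ˡ xs x∉ ∷ uxs , uys , λ
  { (hd , i)   → All.lookup (Allₚ.++⁻ʳ xs x∉) i refl
  ; (tl i , j) → disj (i , j) }

unique-∉ : {x : A} {xs : List A} → Unique (x ∷ xs) → x ∉ xs
unique-∉ = Uniqueₚ.Unique[x∷xs]⇒x∉xs

-- Regroups the labels so that an induction can continue with `c` below `a` and with `s` below `u`.
unique-node : ∀ {u a : A} c {s} → Unique (u ∷ labels (node a c s)) →
  Unique (a ∷ labels c) × Unique (u ∷ labels s) × Disjoint (a ∷ labels c) (u ∷ labels s)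
unique-node {u = u} {a} c {s} uniq =
  unique-++⁻ (a ∷ labels c) (unique-resp-↭ (↭-sym (shift u (a ∷ labels c) (labels s))) uniq)

lastOf : A → List A → A
lastOf x []       = x
lastOf x (y ∷ ys) = lastOf y ys

lastOf∈ : (x : A) (xs : List A) → lastOf x xs ∈ x ∷ xs
lastOf∈ x []       = hd
lastOf∈ x (y ∷ ys) = tl (lastOf∈ y ys)

last≡lastOf : (x : A) (xs : List A) → L⁺.last (x L⁺.∷ xs) ≡ lastOf x xs
last≡lastOf x []       = refl
last≡lastOf x (y ∷ ys) = trans (last-∷ x y ys) (last≡lastOf y ys)
  where
  last-∷ : (x y : A) (ys : List A) → L⁺.last (x L⁺.∷ y ∷ ys) ≡ L⁺.last (y L⁺.∷ ys)
  last-∷ x y ys with initLast ys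
  ... | []       = refl
  ... | _ ∷ʳ′ _  = refl

-- Edge u f x y: below the root u of the forest f, the vertex x is the parent of y.
data Edge {A : Set} : A → Forest A → A → A → Set where
  root    : ∀ {u a c s} → Edge u (node a c s) u a
  child   : ∀ {u a c s x y} → Edge a c x y → Edge u (node a c s) x y
  sibling : ∀ {u a c s x y} → Edge u s x y → Edge u (node a c s) x y

parent∈ : ∀ {u : A} {f x y} → Edge u f x y → x ∈ u ∷ labels f
parent∈ root = hd
parent∈ (child e) = tl (∈-++⁺ˡ (parent∈ e))
parent∈ (sibling {a = a} {c} e) with parent∈ e
... | hd   = hd
... | tl i = tl (∈-++⁺ʳ (a ∷ labels c) i)

child∈ : ∀ {u : A} {f x y} → Edge u f x y → y ∈ labels f
child∈ root = hd
child∈ (child e) = ∈-++⁺ˡ (tl (child∈ e))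
child∈ (sibling {a = a} {c} e) = ∈-++⁺ʳ (a ∷ labels c) (child∈ e)

-- The descendants of the lower end of an edge form one side of a cut that
-- only this edge crosses.
record Cut {A : Set} (u : A) (f : Forest A) (x y : A) : Set where
  field
    side     : List A
    below    : ∀ {v} → v ∈ side → v ∈ labels f
    y∈side   : y ∈ side
    x∉side   : x ∉ side
    downward : ∀ {p q} → Edge u f p q → p ∈ side → q ∈ side
    upward   : ∀ {p q} → Edge u f p q → q ∈ side → p ∈ side ⊎ (p ≡ x × q ≡ y)

-- The top edge cuts off the whole tree at `a`. A cut inside `c` or `s` stays one in the larger
-- forest: labels are distinct and its side omits the root, so no further edge meets the side.
edge-cut : ∀ {u : A} {f x y} → Unique (u ∷ labels f) → Edge u f x y → Cut u f x y
edge-cut {f = node a c s} uniq root with unique-node c uniq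
... | _ , _ , disjoint = record
  { side     = a ∷ labels c
  ; below    = ∈-++⁺ˡ
  ; y∈side   = hd
  ; x∉side   = λ i → disjoint (i , hd)
  ; downward = λ
    { root        _ → hd
    ; (child e)   _ → tl (child∈ e)
    ; (sibling e) i → ⊥-elim (disjoint (i , parent∈ e)) }
  ; upward   = λ
    { root        _ → inj₂ (refl , refl)
    ; (child e)   _ → inj₁ (parent∈ e)
    ; (sibling e) i → ⊥-elim (disjoint (i , tl (child∈ e))) }
  }
edge-cut {u = u} {node a c s} uniq (child e) with unique-node c uniq
... | uniq-c , _ , disjoint = record
  { side     = side
  ; below    = ∈-++⁺ˡ ∘ tl ∘ below
  ; y∈side   = y∈side
  ; x∉side   = x∉side
  ; downward = λ
    { root         i → ⊥-elim (disjoint (tl (below i) , hd))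
    ; (child e′)   i → downward e′ i
    ; (sibling e′) i → ⊥-elim (disjoint (tl (below i) , parent∈ e′)) }
  ; upward   = λ
    { root         i → ⊥-elim (unique-∉ uniq-c (below i))
    ; (child e′)   i → upward e′ i
    ; (sibling e′) i → ⊥-elim (disjoint (tl (below i) , tl (child∈ e′))) }
  }
  where open Cut (edge-cut uniq-c e)
edge-cut {u = u} {node a c s} uniq (sibling e) with unique-node c uniq
... | _ , uniq-s , disjoint = record
  { side     = side
  ; below    = ∈-++⁺ʳ (a ∷ labels c) ∘ below
  ; y∈side   = y∈side
  ; x∉side   = x∉side
  ; downward = λ
    { root         i → ⊥-elim (unique-∉ uniq-s (below i))
    ; (child e′)   i → ⊥-elim (disjoint (parent∈ e′ , tl (below i)))
    ; (sibling e′) i → downward e′ i }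
  ; upward   = λ
    { root         i → ⊥-elim (disjoint (hd , tl (below i)))
    ; (child e′)   i → ⊥-elim (disjoint (tl (child∈ e′) , tl (below i)))
    ; (sibling e′) i → upward e′ i }
  }
  where open Cut (edge-cut uniq-s e)

-- Subtrees at the root as parent-closed sets.

record Realises {n} (G : Graph n) (r : Fin n) (f : Forest (Fin n)) : Set where
  field
    unique   : Unique (r ∷ labels f)
    complete : ∀ v → v ∈ r ∷ labels f
    edge⇒adj : ∀ {u v} → Edge r f u v → Adj G u v
    adj⇒edge : ∀ {u v} → Adj G u v → Edge r f u v ⊎ Edge r f v u

DownClosed : ∀ {n} → Fin n → Forest (Fin n) → Subset n → Set
DownClosed r f S = ∀ {x y} → Edge r f x y → y ∈ₛ S → x ∈ₛ S

module _ {n : ℕ} {G : Graph n} where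

  Adj-sym : ∀ {u v} → Adj G u v → Adj G v u
  Adj-sym {u} {v} a = trans (Graph.sym G v u) a

  walk-start : ∀ {S u v} → WalkIn G S u v → u ∈ₛ S
  walk-start (here i)     = i
  walk-start (step i _ _) = i

  walk-trans : ∀ {S u v w} → WalkIn G S u v → WalkIn G S v w → WalkIn G S u w
  walk-trans (here _)     q = q
  walk-trans (step i a p) q = step i a (walk-trans p q)

  walk-sym : ∀ {S u v} → WalkIn G S u v → WalkIn G S v u
  walk-sym (here i)     = here i
  walk-sym (step i a p) =
    walk-trans (walk-sym p) (step (walk-start p) (Adj-sym a) (here i))

  walk-up : ∀ {S u} f → (∀ {x y} → Edge u f x y → Adj G x y) → DownClosed u f S →
    ∀ {v} → v ∈ labels f → v ∈ₛ S → WalkIn G S v u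
  walk-up {u = u} (node a c s) adjacent closed i v∈S with ∈-++⁻ (a ∷ labels c) i
  ... | inj₁ hd     = step v∈S (Adj-sym (adjacent root)) (here (closed root v∈S))
  ... | inj₁ (tl j) =
    let p = walk-up c (adjacent ∘ child) (closed ∘ child) j v∈S
        a∈S = walk-start (walk-sym p)
    in walk-trans p (step a∈S (Adj-sym (adjacent root)) (here (closed root a∈S)))
  ... | inj₂ j = walk-up s (adjacent ∘ sibling) (closed ∘ sibling) j v∈S

module _ {n : ℕ} {G : Graph n} {r : Fin n} {f : Forest (Fin n)} (R : Realises G r f) where
  open Realises R

  walk-to-root : ∀ {S} → DownClosed r f S → ∀ {v} → v ∈ₛ S → WalkIn G S v r
  walk-to-root closed {v} v∈S with complete v
  ... | hd   = here v∈S
  ... | tl i = walk-up f edge⇒adj closed i v∈S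

  connected : Connected G
  connected u v = walk-trans (walk-to-root (λ _ _ → ∈⊤) ∈⊤) (walk-sym (walk-to-root (λ _ _ → ∈⊤) ∈⊤))

  -- The walk can leave the side only through the edge from `y` to `x`, so it visits `x`.
  walk-leaves : ∀ {S x y a b} (cut : Cut r f x y) → WalkIn G S a b →
    a ∈ Cut.side cut → b ∉ Cut.side cut → x ∈ₛ S
  walk-leaves cut (here _) a∈ b∉ = ⊥-elim (b∉ a∈)
  walk-leaves cut (step _ adj p) a∈ b∉ with adj⇒edge adj
  ... | inj₁ e = walk-leaves cut p (Cut.downward cut e a∈) b∉
  ... | inj₂ e with Cut.upward cut e a∈
  ...   | inj₁ w∈          = walk-leaves cut p w∈ b∉
  ...   | inj₂ (refl , _)  = walk-start p

  -- A walk from a vertex to the root inside a connected set must cross the cut at the parent edge,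
  -- hence passes the parent. Conversely, in a closed set any two vertices are joined by way of the
  -- root.
  subtree⇔closed : ∀ S → IsSubtreeAt G r S ⇔ (r ∈ₛ S × DownClosed r f S)
  subtree⇔closed S = mk⇔ to from
    where
    to : IsSubtreeAt G r S → r ∈ₛ S × DownClosed r f S
    to (r∈S , walks) = r∈S , λ e y∈S →
      let cut = edge-cut unique e
      in walk-leaves cut (walks _ _ y∈S r∈S) (Cut.y∈side cut) (unique-∉ unique ∘ Cut.below cut)
    from : r ∈ₛ S × DownClosed r f S → IsSubtreeAt G r S
    from (r∈S , closed) = r∈S , λ u v u∈S v∈S →
      walk-trans (walk-to-root closed u∈S) (walk-sym (walk-to-root closed v∈S))

  side-stable : ∀ {x y} (cut : Cut r f x y) {p q} → Adj G p q →
    ¬ (p ≡ x × q ≡ y) → ¬ (q ≡ x × p ≡ y) → p ∈ Cut.side cut ⇔ q ∈ Cut.side cut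
  side-stable cut a pq qp with adj⇒edge a
  ... | inj₁ e = mk⇔ (Cut.downward cut e) (λ i → [ (λ j → j) , ⊥-elim ∘ pq ]′ (Cut.upward cut e i))
  ... | inj₂ e = mk⇔ (λ i → [ (λ j → j) , ⊥-elim ∘ qp ]′ (Cut.upward cut e i)) (Cut.downward cut e)

  -- A chain that avoids one end `v` of the cut edge cannot use this edge, so it never changes
  -- sides.
  chain-stable : ∀ {x y} (cut : Cut r f x y) {v} → v ≡ x ⊎ v ≡ y → ∀ w ws →
    Chain G (w ∷ ws) → v ∉ w ∷ ws → w ∈ Cut.side cut ⇔ lastOf w ws ∈ Cut.side cut
  chain-stable cut v≡ w [] _ _ = mk⇔ (λ i → i) (λ i → i)
  chain-stable cut v≡ w (w′ ∷ ws) (cons a ch) v∉ =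
    chain-stable cut v≡ w′ ws ch (v∉ ∘ tl) ⇔-∘ side-stable cut a
      (λ { (refl , refl) → v∉ ([ (λ { refl → hd }) , (λ { refl → tl hd }) ]′ v≡) })
      (λ { (refl , refl) → v∉ ([ (λ { refl → tl hd }) , (λ { refl → hd }) ]′ v≡) })

  -- The rest of a cycle through the edge x y does not cross the cut at this edge.
  acyclic : ¬ HasCycle G
  acyclic (x , y , z , rest , uniq@(_ ∷ uniq-y) , cons xy ch , lx) = [ from-x , from-y ]′ (adj⇒edge xy)
    where
    l = lastOf z rest
    l≢ : ∀ {v} → v ∉ z ∷ rest → l ≢ v
    l≢ v∉ refl = v∉ (lastOf∈ z rest)
    l≢x : l ≢ x
    l≢x = l≢ (unique-∉ uniq ∘ tl)
    l≢y : l ≢ y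
    l≢y = l≢ (unique-∉ uniq-y)
    around : ∀ {p q} (cut : Cut r f p q) → x ≡ p ⊎ x ≡ q → ¬ (l ≡ p × x ≡ q) → ¬ (x ≡ p × l ≡ q) →
      y ∈ Cut.side cut ⇔ x ∈ Cut.side cut
    around cut x≡ lx≢ xl≢ =
      side-stable cut (subst (λ v → Adj G v x) (last≡lastOf z rest) lx) lx≢ xl≢
      ⇔-∘ chain-stable cut x≡ y (z ∷ rest) ch (unique-∉ uniq)
    from-x : ¬ Edge r f x y
    from-x e = Cut.x∉side cut (Equivalence.to
      (around cut (inj₁ refl) (l≢x ∘ proj₁) (l≢y ∘ proj₂)) (Cut.y∈side cut))
      where cut = edge-cut unique e
    from-y : ¬ Edge r f y x
    from-y e = Cut.x∉side cut (Equivalence.from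
      (around cut (inj₂ refl) (l≢y ∘ proj₁) (l≢x ∘ proj₂)) (Cut.y∈side cut))
      where cut = edge-cut unique e

  realises⇒isTree : IsTree G
  realises⇒isTree = connected , acyclic

-- Spanning trees

does⇒ : {P : Set} (P? : Dec P) → does P? ≡ true → P
does⇒ (yes p) _ = p

module _ {n : ℕ} where

  

  edge? : (u : Fin n) (f : Forest (Fin n)) (x y : Fin n) → Dec (Edge u f x y)
  edge? u ∅ x y = no λ ()
  edge? u (node a c s) x y =
    map′ to from ((u Finₚ.≟ x ×-dec a Finₚ.≟ y) ⊎-dec (edge? a c x y ⊎-dec edge? u s x y))
    where
    to : (u ≡ x × a ≡ y) ⊎ (Edge a c x y ⊎ Edge u s x y) → Edge u (node a c s) x y
    to (inj₁ (refl , refl)) = root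
    to (inj₂ (inj₁ e))      = child e
    to (inj₂ (inj₂ e))      = sibling e
    from : Edge u (node a c s) x y → (u ≡ x × a ≡ y) ⊎ (Edge a c x y ⊎ Edge u s x y)
    from root        = inj₁ (refl , refl)
    from (child e)   = inj₂ (inj₁ e)
    from (sibling e) = inj₂ (inj₂ e)

  edge-irrefl : ∀ {u f x} → Unique (u ∷ labels f) → ¬ Edge {Fin n} u f x x
  edge-irrefl uniq e = Cut.x∉side cut (Cut.y∈side cut)
    where cut = edge-cut uniq e

  -- Turns a rearranged forest back into a graph, as a competitor for the maximality hypothesis and
  -- as the spanning tree of a given graph.
  treeGraph : (r : Fin n) (f : Forest (Fin n)) → Unique (r ∷ labels f) → Graph n
  treeGraph r f uniq = record
    { adj    = λ u v → does (link? u v)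
    ; sym    = λ u v → ∨-comm (does (edge? r f u v)) (does (edge? r f v u))
    ; irrefl = λ u → dec-false (link? u u) [ edge-irrefl uniq , edge-irrefl uniq ]′
    }
    where
    link? : ∀ u v → Dec (Edge r f u v ⊎ Edge r f v u)
    link? u v = edge? r f u v ⊎-dec edge? r f v u

  treeGraph-realises : (r : Fin n) (f : Forest (Fin n)) (uniq : Unique (r ∷ labels f)) →
    (∀ v → v ∈ r ∷ labels f) → Realises (treeGraph r f uniq) r f
  treeGraph-realises r f uniq complete = record
    { unique   = uniq
    ; complete = complete
    ; edge⇒adj = λ {u} {v} e → dec-true (edge? r f u v ⊎-dec edge? r f v u) (inj₁ e)
    ; adj⇒edge = λ {u} {v} a → does⇒ (edge? r f u v ⊎-dec edge? r f v u) a
    }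

  record SimplePath (G : Graph n) (u v : Fin n) : Set where
    constructor path
    field
      rest   : List (Fin n)
      unique : Unique (u ∷ rest)
      chain  : Chain G (u ∷ rest)
      ends   : lastOf u rest ≡ v

  suffix-path : ∀ {G u v} w ws → u ∈ w ∷ ws → Unique (w ∷ ws) → Chain G (w ∷ ws) →
    lastOf w ws ≡ v → SimplePath G u v
  suffix-path w ws hd uniq ch ends = path ws uniq ch ends
  suffix-path w (w′ ∷ ws) (tl i) (_ ∷ uniq) (cons _ ch) ends = suffix-path w′ ws i uniq ch ends

  -- Loop erasure: if `u` recurs on the path found for the rest of the walk, only the part from that
  -- occurrence on is kept.
  walk⇒path : ∀ {G S u v} → WalkIn G S u v → SimplePath G u v
  walk⇒path (here _) = path [] ([] ∷ []) (one _) refl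
  walk⇒path {u = u} (step {w = w} _ a p) with walk⇒path p
  ... | path ws uniq ch ends with mem? Finₚ._≟_ u (w ∷ ws)
  ...   | yes i  = suffix-path w ws i uniq ch ends
  ...   | no  u∉ = path (w ∷ ws) (Allₚ.¬Any⇒All¬ _ u∉ ∷ uniq) (cons a ch) ends

  chain-mono : ∀ {G H : Graph n} → (∀ {u v} → Adj G u v → Adj H u v) → ∀ {ws} → Chain G ws → Chain H ws
  chain-mono sub nil         = nil
  chain-mono sub (one x)     = one x
  chain-mono sub (cons a ch) = cons (sub a) (chain-mono sub ch)

-- The edges are bounded only from above, which is what keeps a growing partial tree inside the
-- graph.
graft : ∀ {u : A} f {x} y → x ∈ u ∷ labels f → ∃ λ f′ → labels f′ ↭ y ∷ labels f
  × (∀ {p q} → Edge u f′ p q → Edge u f p q ⊎ (p ≡ x × q ≡ y))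
graft f y hd = node y ∅ f , ↭-refl , λ
  { root        → inj₂ (refl , refl)
  ; (sibling e) → inj₁ e }
graft (node a c s) y (tl i) with ∈-++⁻ (a ∷ labels c) i
... | inj₁ j with graft c y j
...   | c′ , p , edges = node a c′ s
  , ↭-trans (prep a (++⁺ʳ (labels s) p)) (swap a y ↭-refl) , λ
  { root        → inj₁ root
  ; (child e)   → [ inj₁ ∘ child , inj₂ ]′ (edges e)
  ; (sibling e) → inj₁ (sibling e) }
graft (node a c s) y (tl i) | inj₂ j with graft s y (tl j)
... | s′ , p , edges = node a c s′
  , ↭-trans (++⁺ˡ (a ∷ labels c) p) (shift y (a ∷ labels c) (labels s)) , λ
  { root        → inj₁ root
  ; (child e)   → inj₁ (child e)
  ; (sibling e) → [ inj₁ ∘ sibling , inj₂ ]′ (edges e) }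

module _ {n : ℕ} (G : Graph n) (r : Fin n) where

  record Partial : Set where
    field
      forest   : Forest (Fin n)
      unique   : Unique (r ∷ labels forest)
      edge⇒adj : ∀ {u v} → Edge r forest u v → Adj G u v

  open Partial

  vertices : Partial → List (Fin n)
  vertices P = r ∷ labels (forest P)

  _⊑_ : Partial → Partial → Set
  P ⊑ Q = ∀ {v} → v ∈ vertices P → v ∈ vertices Q

  add-neighbour : (P : Partial) → ∀ {x y} → x ∈ vertices P → Adj G x y →
    ∃ λ Q → P ⊑ Q × y ∈ vertices Q
  add-neighbour P {x} {y} x∈ a with mem? Finₚ._≟_ y (vertices P)
  ... | yes y∈ = P , (λ i → i) , y∈
  ... | no  y∉ with graft (forest P) y x∈
  ...   | f′ , p , edges = record
    { forest   = f′
    ; unique   = unique-resp-↭ (↭-sym p′) (Allₚ.¬Any⇒All¬ _ y∉ ∷ unique P)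
    ; edge⇒adj = λ e → [ edge⇒adj P , (λ { (refl , refl) → a }) ]′ (edges e)
    } , ∈-resp-↭ (↭-sym p′) ∘ tl , ∈-resp-↭ (↭-sym p′) hd
    where
    p′ : r ∷ labels f′ ↭ y ∷ vertices P
    p′ = ↭-trans (prep r p) (swap r y ↭-refl)

  grow-along : ∀ {S x v} → WalkIn G S x v → (P : Partial) → x ∈ vertices P →
    ∃ λ Q → P ⊑ Q × v ∈ vertices Q
  grow-along (here _) P x∈ = P , (λ i → i) , x∈
  grow-along (step _ a p) P x∈ with add-neighbour P x∈ a
  ... | Q , P⊑Q , w∈ with grow-along p Q w∈
  ...   | Q′ , Q⊑Q′ , v∈ = Q′ , Q⊑Q′ ∘ P⊑Q , v∈

  spanning : Connected G → (vs : List (Fin n)) → Σ Partial λ P → All (_∈ vertices P) vs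
  spanning conn [] = record { forest = ∅ ; unique = [] ∷ [] ; edge⇒adj = λ () } , []
  spanning conn (v ∷ vs) with spanning conn vs
  ... | P , vs∈ with grow-along (conn r v) P hd
  ...   | Q , P⊑Q , v∈ = Q , v∈ ∷ All.map P⊑Q vs∈

  -- An edge outside a spanning tree closes the tree path between its ends to a cycle.
  isTree⇒realises : IsTree G → Σ (Forest (Fin n)) (Realises G r)
  isTree⇒realises (conn , acyc) with spanning conn (allFin n)
  ... | P , all∈ = forest P , record
    { unique   = unique P
    ; complete = complete
    ; edge⇒adj = edge⇒adj P
    ; adj⇒edge = λ a → close a (walk⇒path (connected R _ _))
    }
    where
    complete : ∀ v → v ∈ vertices P
    complete v = All.lookup all∈ (∈-allFin v)
    H = treeGraph r (forest P) (unique P)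
    R : Realises H r (forest P)
    R = treeGraph-realises r (forest P) (unique P) complete
    H⊆G : ∀ {u v} → Adj H u v → Adj G u v
    H⊆G a = [ edge⇒adj P , Adj-sym {G = G} ∘ edge⇒adj P ]′ (Realises.adj⇒edge R a)
    -- By the length of the tree path: length 0 would make the edge a loop, length 1 makes it a tree
    -- edge, and a longer path closes to a cycle.
    close : ∀ {u v} → Adj G u v → SimplePath H u v → Edge r (forest P) u v ⊎ Edge r (forest P) v u
    close {u} a (path [] _ _ refl) with trans (≡-sym a) (Graph.irrefl G u)
    ... | ()
    close a (path (_ ∷ []) _ (cons a′ _) refl) = Realises.adj⇒edge R a′
    close {u} {v} a (path (y ∷ z ∷ rest) uniq ch ends) = ⊥-elim (acyc
      (u , y , z , rest , uniq , chain-mono {G = H} {H = G} H⊆G ch ,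
       subst (λ l → Adj G l u) (trans (≡-sym ends) (≡-sym (last≡lastOf z rest))) (Adj-sym {G = G} a)))

-- Enumeration of the subtrees at the root

-- A parent-closed set as a sequence of choices: `skip` omits `a` and therefore all of `c`. Its
-- constructors mirror the recursion of `count` and `total`.
data Closed {A : Set} : Forest A → Set where
  empty : Closed ∅
  skip  : ∀ {a c s} → Closed s → Closed (node a c s)
  take  : ∀ {a c s} → Closed c → Closed s → Closed (node a c s)

elements : {f : Forest A} → Closed f → List A
elements empty                 = []
elements (skip q)              = elements q
elements (take {a = a} p q)    = a ∷ elements p ++ elements q

elements⊆ : {f : Forest A} (p : Closed f) → ∀ {v} → v ∈ elements p → v ∈ labels f
elements⊆ (skip {a = a} {c} q) i = ∈-++⁺ʳ (a ∷ labels c) (elements⊆ q i)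
elements⊆ (take p q) hd = hd
elements⊆ (take {a = a} {c} p q) (tl i) with ∈-++⁻ (elements p) i
... | inj₁ j = ∈-++⁺ˡ (tl (elements⊆ p j))
... | inj₂ j = ∈-++⁺ʳ (a ∷ labels c) (elements⊆ q j)

elements-unique : ∀ {u : A} {f} → Unique (u ∷ labels f) → (p : Closed f) → Unique (elements p)
elements-unique uniq empty = []
elements-unique uniq (skip {c = c} q) = elements-unique (proj₁ (proj₂ (unique-node c uniq))) q
elements-unique uniq (take {a = a} {c} {s} p q) with unique-node c uniq
... | uniq-c , uniq-s , disjoint = Uniqueₚ.++⁺ {xs = a ∷ elements p}
  (Allₚ.¬Any⇒All¬ _ (unique-∉ uniq-c ∘ elements⊆ p) ∷ elements-unique uniq-c p)
  (elements-unique uniq-s q)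
  (λ { (hd , j)   → disjoint (hd , tl (elements⊆ q j))
     ; (tl i , j) → disjoint (tl (elements⊆ p i) , tl (elements⊆ q j)) })

-- Whether `a` occurs decides between `skip` and `take`; distinct labels then separate the elements
-- from `c` and those from `s`.
elements-injective : ∀ {u : A} {f} → Unique (u ∷ labels f) → (p q : Closed f) →
  (∀ {v} → v ∈ elements p → v ∈ elements q) → (∀ {v} → v ∈ elements q → v ∈ elements p) → p ≡ q
elements-injective uniq empty empty _ _ = refl
elements-injective uniq (skip {c = c} p) (skip q) p⊆q q⊆p =
  cong skip (elements-injective (proj₁ (proj₂ (unique-node c uniq))) p q p⊆q q⊆p)
elements-injective uniq (skip {c = c} p) (take _ _) _ q⊆p with unique-node c uniq
... | _ , _ , disjoint = ⊥-elim (disjoint (hd , tl (elements⊆ p (q⊆p hd))))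
elements-injective uniq (take {c = c} _ _) (skip q) p⊆q _ with unique-node c uniq
... | _ , _ , disjoint = ⊥-elim (disjoint (hd , tl (elements⊆ q (p⊆q hd))))
elements-injective uniq (take {c = c} p p′) (take q q′) p⊆q q⊆p with unique-node c uniq
... | uniq-c , uniq-s , disjoint = cong₂ take
  (elements-injective uniq-c p q (first p p′ q q′ p⊆q) (first q q′ p p′ q⊆p))
  (elements-injective uniq-s p′ q′ (second p p′ q q′ p⊆q) (second q q′ p p′ q⊆p))
  where
  first : ∀ p p′ q q′ → (∀ {v} → v ∈ elements (take p p′) → v ∈ elements (take q q′)) →
    ∀ {v} → v ∈ elements p → v ∈ elements q
  first p p′ q q′ sub i with sub (tl (∈-++⁺ˡ i))
  ... | hd   = ⊥-elim (unique-∉ uniq-c (elements⊆ p i))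
  ... | tl j with ∈-++⁻ (elements q) j
  ...   | inj₁ k = k
  ...   | inj₂ k = ⊥-elim (disjoint (tl (elements⊆ p i) , tl (elements⊆ q′ k)))
  second : ∀ p p′ q q′ → (∀ {v} → v ∈ elements (take p p′) → v ∈ elements (take q q′)) →
    ∀ {v} → v ∈ elements p′ → v ∈ elements q′
  second p p′ q q′ sub i with sub (tl (∈-++⁺ʳ (elements p) i))
  ... | hd   = ⊥-elim (disjoint (hd , tl (elements⊆ p′ i)))
  ... | tl j with ∈-++⁻ (elements q) j
  ...   | inj₁ k = ⊥-elim (disjoint (tl (elements⊆ q k) , tl (elements⊆ p′ i)))
  ...   | inj₂ k = k

allClosed : (f : Forest A) → List (Closed f)
allClosed ∅            = empty ∷ []
allClosed (node a c s) = map skip (allClosed s) ++ cartesianProductWith take (allClosed c) (allClosed s)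

∈-allClosed : {f : Forest A} (p : Closed f) → p ∈ allClosed f
∈-allClosed empty      = hd
∈-allClosed (skip q)   = ∈-++⁺ˡ (∈-map⁺ skip (∈-allClosed q))
∈-allClosed (take {s = s} p q) =
  ∈-++⁺ʳ (map skip (allClosed s)) (∈-cartesianProductWith⁺ take (∈-allClosed p) (∈-allClosed q))

allClosed-unique : (f : Forest A) → Unique (allClosed f)
allClosed-unique ∅            = [] ∷ []
allClosed-unique (node a c s) = Uniqueₚ.++⁺
  (Uniqueₚ.map⁺ (λ { refl → refl }) (allClosed-unique s))
  (Uniqueₚ.cartesianProductWith⁺ take (λ { refl → refl , refl }) (allClosed-unique c) (allClosed-unique s))
  disjoint
  where
  disjoint : Disjoint (map skip (allClosed s)) (cartesianProductWith take (allClosed c) (allClosed s))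
  disjoint (i , j) with ∈-map⁻ skip i | ∈-cartesianProductWith⁻ take (allClosed c) (allClosed s) j
  ... | _ , _ , refl | _ , _ , _ , _ , ()

length-cartesianProductWith : {B C D : Set} (g : B → C → D) (xs : List B) (ys : List C) →
  length (cartesianProductWith g xs ys) ≡ length xs * length ys
length-cartesianProductWith g []       ys = refl
length-cartesianProductWith g (x ∷ xs) ys = trans (Listₚ.length-++ (map (g x) ys))
  (cong₂ _+_ (Listₚ.length-map (g x) ys) (length-cartesianProductWith g xs ys))

length-allClosed : (f : Forest A) → length (allClosed f) ≡ count f
length-allClosed ∅            = refl
length-allClosed (node a c s) = begin
  length (map skip L ++ cartesianProductWith take K L)
    ≡⟨ Listₚ.length-++ (map skip L) ⟩
  length (map skip L) + length (cartesianProductWith take K L)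
    ≡⟨ cong₂ _+_ (Listₚ.length-map skip L) (length-cartesianProductWith take K L) ⟩
  length L + length K * length L
    ≡⟨ cong₂ (λ k l → l + k * l) (length-allClosed c) (length-allClosed s) ⟩
  suc (count c) * count s ∎
  where
  open ≡-Reasoning
  K = allClosed c
  L = allClosed s

weight : {f : Forest A} → Closed f → ℕ
weight p = length (elements p)

sum-map-shift : {B : Set} (k : ℕ) (g : B → ℕ) (xs : List B) →
  sum (map (λ x → k + g x) xs) ≡ k * length xs + sum (map g xs)
sum-map-shift k g []       = eq k
  where
  eq : ∀ k → 0 ≡ k * 0 + 0
  eq = solve-∀
sum-map-shift k g (x ∷ xs) = begin
  k + g x + sum (map (λ x → k + g x) xs)         ≡⟨ cong (k + g x +_) (sum-map-shift k g xs) ⟩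
  k + g x + (k * length xs + sum (map g xs))     ≡⟨ eq k (g x) (length xs) (sum (map g xs)) ⟩
  k * suc (length xs) + (g x + sum (map g xs))   ∎
  where
  open ≡-Reasoning
  eq : ∀ k a b c → k + a + (k * b + c) ≡ k * suc b + (a + c)
  eq = solve-∀

sum-weight-take : ∀ {a : A} {c s} (ps : List (Closed c)) (qs : List (Closed s)) →
  sum (map (weight {f = node a c s}) (cartesianProductWith take ps qs))
  ≡ (length ps + sum (map weight ps)) * length qs + length ps * sum (map weight qs)
sum-weight-take []       qs = refl
sum-weight-take {a = a} {c} {s} (p ∷ ps) qs = begin
  sum (map weight (map (take p) qs ++ rest))
    ≡⟨ cong sum (Listₚ.map-++ weight (map (take p) qs) rest) ⟩
  sum (map weight (map (take p) qs) ++ map weight rest)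
    ≡⟨ sum-++ (map weight (map (take p) qs)) _ ⟩
  sum (map weight (map (take p) qs)) + sum (map weight rest)
    ≡⟨ cong₂ _+_ head (sum-weight-take ps qs) ⟩
  (suc (weight p) * length qs + sum (map weight qs))
    + ((length ps + sum (map weight ps)) * length qs + length ps * sum (map weight qs))
    ≡⟨ eq (weight p) (length qs) (length ps) (sum (map weight ps)) (sum (map weight qs)) ⟩
  (length (p ∷ ps) + sum (map weight (p ∷ ps))) * length qs + length (p ∷ ps) * sum (map weight qs) ∎
  where
  open ≡-Reasoning
  rest = cartesianProductWith (take {a = a} {c} {s}) ps qs
  eq : ∀ w l k v u → (suc w * l + u) + ((k + v) * l + k * u) ≡ (suc k + (w + v)) * l + suc k * u
  eq = solve-∀
  head : sum (map (weight {f = node a c s}) (map (take p) qs)) ≡ suc (weight p) * length qs + sum (map weight qs)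
  head = begin
    sum (map weight (map (take p) qs))             ≡⟨ cong sum (Listₚ.map-∘ qs) ⟨
    sum (map (weight ∘ take {a = a} p) qs)                 ≡⟨ cong sum (Listₚ.map-cong (λ q → cong suc (Listₚ.length-++ (elements p) {elements q})) qs) ⟩
    sum (map (λ q → suc (weight p) + weight q) qs) ≡⟨ sum-map-shift (suc (weight p)) weight qs ⟩
    suc (weight p) * length qs + sum (map weight qs) ∎

sum-weight : (f : Forest A) → sum (map weight (allClosed f)) ≡ total f
sum-weight ∅            = refl
sum-weight (node a c s) = begin
  sum (map weight (map skip L ++ KL))
    ≡⟨ cong sum (Listₚ.map-++ weight (map skip L) KL) ⟩
  sum (map weight (map skip L) ++ map weight KL)
    ≡⟨ sum-++ (map weight (map skip L)) _ ⟩
  sum (map weight (map skip L)) + sum (map weight KL)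
    ≡⟨ cong₂ _+_ (cong sum (≡-sym (Listₚ.map-∘ L))) (sum-weight-take K L) ⟩
  sum (map weight L) + ((length K + sum (map weight K)) * length L + length K * sum (map weight L))
    ≡⟨ cong₂ (λ k l → sum (map weight L) + ((k + sum (map weight K)) * l + k * sum (map weight L)))
         (length-allClosed c) (length-allClosed s) ⟩
  sum (map weight L) + ((count c + sum (map weight K)) * count s + count c * sum (map weight L))
    ≡⟨ cong₂ (λ v w → w + ((count c + v) * count s + count c * w)) (sum-weight c) (sum-weight s) ⟩
  total s + ((count c + total c) * count s + count c * total s)
    ≡⟨ eq (total s) ((count c + total c) * count s) (count c) ⟩
  total (node a c s) ∎
  where
  open ≡-Reasoning
  K = allClosed c
  L = allClosed s
  KL = cartesianProductWith (take {a = a}) K L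
  eq : ∀ w x p → w + (x + p * w) ≡ x + suc p * w
  eq = solve-∀

-- Closed sets as subsets of the vertex set.

∣insert∣ : ∀ {n} (p : Subset n) (v : Fin n) → ¬ v ∈ₛ p → ∣ p [ v ]≔ inside ∣ ≡ suc ∣ p ∣
∣insert∣ (inside  ∷ p) zero    v∉ = ⊥-elim (v∉ here)
∣insert∣ (outside ∷ p) zero    v∉ = refl
∣insert∣ (inside  ∷ p) (suc v) v∉ = cong suc (∣insert∣ p v (v∉ ∘ there))
∣insert∣ (outside ∷ p) (suc v) v∉ = ∣insert∣ p v (v∉ ∘ there)

module _ {n : ℕ} where

  fromList : List (Fin n) → Subset n
  fromList []       = ⊥ₛ
  fromList (v ∷ vs) = fromList vs [ v ]≔ inside

  ∈-fromList⁺ : ∀ {v} vs → v ∈ vs → v ∈ₛ fromList vs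
  ∈-fromList⁺ (v ∷ vs) hd = []≔-updates (fromList vs) v
  ∈-fromList⁺ {v} (w ∷ vs) (tl i) with v Finₚ.≟ w
  ... | yes refl = []≔-updates (fromList vs) v
  ... | no  v≢w  = []≔-minimal (fromList vs) v w v≢w (∈-fromList⁺ vs i)

  ∈-fromList⁻ : ∀ {v} vs → v ∈ₛ fromList vs → v ∈ vs
  ∈-fromList⁻ [] i = ⊥-elim (∉⊥ i)
  ∈-fromList⁻ {v} (w ∷ vs) i with v Finₚ.≟ w
  ... | yes refl = hd
  ... | no  v≢w  = tl (∈-fromList⁻ vs (lookup⇒[]= v (fromList vs)
    (trans (≡-sym (lookup∘update′ v≢w (fromList vs) inside)) ([]=⇒lookup i))))

  ∣fromList∣ : ∀ {vs} → Unique vs → ∣ fromList vs ∣ ≡ length vs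
  ∣fromList∣ {[]}     _ = ∣⊥∣≡0 n
  ∣fromList∣ {v ∷ vs} uniq@(_ ∷ u) =
    trans (∣insert∣ (fromList vs) v (unique-∉ uniq ∘ ∈-fromList⁻ vs)) (cong suc (∣fromList∣ u))

  root∈closed : ∀ {u : Fin n} {S v} f → DownClosed u f S → v ∈ labels f → v ∈ₛ S → u ∈ₛ S
  root∈closed (node b d t) closed i v∈S with ∈-++⁻ (b ∷ labels d) i
  ... | inj₁ hd     = closed root v∈S
  ... | inj₁ (tl j) = closed root (root∈closed d (closed ∘ child) j v∈S)
  ... | inj₂ j      = root∈closed t (closed ∘ sibling) j v∈S

  -- Membership of `a` in `S` selects the constructor. If `a` is missing, so is everything below it
  -- by `root∈closed`, and `skip` loses nothing.
  restrict : ∀ {u : Fin n} {S} f → Unique (u ∷ labels f) → DownClosed u f S →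
    Σ (Closed f) λ p → ∀ {v} → v ∈ elements p ⇔ (v ∈ labels f × v ∈ₛ S)
  restrict ∅ uniq closed = empty , mk⇔ (λ ()) λ { (() , _) }
  restrict {u} {S} (node a c s) uniq closed with unique-node c uniq
  ... | uniq-c , uniq-s , disjoint
    with restrict c uniq-c (closed ∘ child) | restrict s uniq-s (closed ∘ sibling) | a ∈? S
  ...   | p , p⇔ | q , q⇔ | yes a∈S = take p q , mk⇔ to from
    where
    to : ∀ {v} → v ∈ elements (take p q) → v ∈ labels (node a c s) × v ∈ₛ S
    to hd = hd , a∈S
    to (tl i) with ∈-++⁻ (elements p) i
    ... | inj₁ j = let k , v∈S = Equivalence.to p⇔ j in ∈-++⁺ˡ (tl k) , v∈S
    ... | inj₂ j = let k , v∈S = Equivalence.to q⇔ j in ∈-++⁺ʳ (a ∷ labels c) k , v∈S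
    from : ∀ {v} → v ∈ labels (node a c s) × v ∈ₛ S → v ∈ elements (take p q)
    from (i , v∈S) with ∈-++⁻ (a ∷ labels c) i
    ... | inj₁ hd     = hd
    ... | inj₁ (tl j) = tl (∈-++⁺ˡ (Equivalence.from p⇔ (j , v∈S)))
    ... | inj₂ j      = tl (∈-++⁺ʳ (elements p) (Equivalence.from q⇔ (j , v∈S)))
  ...   | p , p⇔ | q , q⇔ | no a∉S = skip q , mk⇔ to from
    where
    to : ∀ {v} → v ∈ elements (skip {a = a} {c} q) → v ∈ labels (node a c s) × v ∈ₛ S
    to j = let k , v∈S = Equivalence.to q⇔ j in ∈-++⁺ʳ (a ∷ labels c) k , v∈S
    from : ∀ {v} → v ∈ labels (node a c s) × v ∈ₛ S → v ∈ elements q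
    from (i , v∈S) with ∈-++⁻ (a ∷ labels c) i
    ... | inj₁ hd     = ⊥-elim (a∉S v∈S)
    ... | inj₁ (tl j) = ⊥-elim (a∉S (root∈closed c (closed ∘ child) j v∈S))
    ... | inj₂ j      = Equivalence.from q⇔ (j , v∈S)

module _ {n : ℕ} {G : Graph n} {r : Fin n} {f : Forest (Fin n)} (R : Realises G r f) where
  open Realises R

  subtree : Closed f → Subset n
  subtree p = fromList (r ∷ elements p)

  ∈-subtree : ∀ p {v} → v ∈ labels f → v ∈ₛ subtree p → v ∈ elements p
  ∈-subtree p i j with ∈-fromList⁻ (r ∷ elements p) j
  ... | hd   = ⊥-elim (unique-∉ unique i)
  ... | tl k = k

  subtree-injective : ∀ {p q} → subtree p ≡ subtree q → p ≡ q
  subtree-injective {p} {q} eq = elements-injective unique p q (sub p q eq) (sub q p (≡-sym eq))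
    where
    sub : ∀ p q → subtree p ≡ subtree q → ∀ {v} → v ∈ elements p → v ∈ elements q
    sub p q eq {v} i = ∈-subtree q (elements⊆ p i)
      (subst (v ∈ₛ_) eq (∈-fromList⁺ (r ∷ elements p) (tl i)))

  elements-closed : ∀ {u : Fin n} {f} → Unique (u ∷ labels f) → (p : Closed f) →
    ∀ {x y} → Edge u f x y → y ∈ elements p → x ∈ u ∷ elements p
  elements-closed uniq (skip {c = c} q) e i with unique-node c uniq
  elements-closed uniq (skip q) root        i | _ , _ , disjoint =
    ⊥-elim (disjoint (hd , tl (elements⊆ q i)))
  elements-closed uniq (skip q) (child e)   i | _ , _ , disjoint =
    ⊥-elim (disjoint (tl (child∈ e) , tl (elements⊆ q i)))
  elements-closed uniq (skip q) (sibling e) i | _ , uniq-s , _ = elements-closed uniq-s q e i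
  elements-closed uniq (take p q) root i = hd
  elements-closed uniq (take {c = c} p q) (child e) i with unique-node c uniq
  ... | uniq-c , _ , disjoint with i
  ...   | hd = ⊥-elim (unique-∉ uniq-c (child∈ e))
  ...   | tl j with ∈-++⁻ (elements p) j
  ...     | inj₁ k = tl (∈-++⁺ˡ (elements-closed uniq-c p e k))
  ...     | inj₂ k = ⊥-elim (disjoint (tl (child∈ e) , tl (elements⊆ q k)))
  elements-closed uniq (take {c = c} p q) (sibling e) i with unique-node c uniq
  ... | _ , uniq-s , disjoint with i
  ...   | hd = ⊥-elim (disjoint (hd , tl (child∈ e)))
  ...   | tl j with ∈-++⁻ (elements p) j
  ...     | inj₁ k = ⊥-elim (disjoint (tl (elements⊆ p k) , tl (child∈ e)))
  ...     | inj₂ k with elements-closed uniq-s q e k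
  ...       | hd   = hd
  ...       | tl l = tl (tl (∈-++⁺ʳ (elements p) l))

  closed-subtree : ∀ p → r ∈ₛ subtree p × DownClosed r f (subtree p)
  closed-subtree p = ∈-fromList⁺ (r ∷ elements p) hd , λ e i →
    ∈-fromList⁺ (r ∷ elements p) (elements-closed unique p e (∈-subtree p (child∈ e) i))

  subtree-surjective : ∀ S → r ∈ₛ S → DownClosed r f S → ∃ λ p → S ≡ subtree p
  subtree-surjective S r∈S closed with restrict f unique closed
  ... | p , p⇔ = p , ⊆-antisym to from
    where
    to : ∀ {v} → v ∈ₛ S → v ∈ₛ subtree p
    to {v} v∈S with complete v
    ... | hd   = ∈-fromList⁺ (r ∷ elements p) hd
    ... | tl i = ∈-fromList⁺ (r ∷ elements p) (tl (Equivalence.from p⇔ (i , v∈S)))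
    from : ∀ {v} → v ∈ₛ subtree p → v ∈ₛ S
    from i with ∈-fromList⁻ (r ∷ elements p) i
    ... | hd   = r∈S
    ... | tl j = proj₂ (Equivalence.to p⇔ j)

  subtrees : List (Subset n)
  subtrees = map subtree (allClosed f)

  ∈-subtrees : ∀ S → S ∈ subtrees ⇔ IsSubtreeAt G r S
  ∈-subtrees S = mk⇔ to from
    where
    to : S ∈ subtrees → IsSubtreeAt G r S
    to i with ∈-map⁻ subtree i
    ... | p , _ , refl = Equivalence.from (subtree⇔closed R S) (closed-subtree p)
    from : IsSubtreeAt G r S → S ∈ subtrees
    from isSubtree with Equivalence.to (subtree⇔closed R S) isSubtree
    ... | r∈S , closed with subtree-surjective S r∈S closed
    ...   | p , refl = ∈-map⁺ subtree (∈-allClosed p)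

  sum-subtrees : sum (map ∣_∣ subtrees) ≡ treeTotal f
  sum-subtrees = begin
    sum (map ∣_∣ subtrees)                     ≡⟨ cong sum (Listₚ.map-∘ (allClosed f)) ⟨
    sum (map (∣_∣ ∘ subtree) (allClosed f))    ≡⟨ cong sum (Listₚ.map-cong ∣subtree∣ (allClosed f)) ⟩
    sum (map (λ p → 1 + weight p) (allClosed f)) ≡⟨ sum-map-shift 1 weight (allClosed f) ⟩
    1 * length (allClosed f) + sum (map weight (allClosed f))
      ≡⟨ cong₂ _+_ (trans (*-identityˡ _) (length-allClosed f)) (sum-weight f) ⟩
    treeTotal f ∎
    where
    open ≡-Reasoning
    ∣subtree∣ : ∀ p → ∣ subtree p ∣ ≡ suc (weight p)
    ∣subtree∣ p = ∣fromList∣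
      (Allₚ.¬Any⇒All¬ _ (unique-∉ unique ∘ elements⊆ p) ∷ elements-unique unique p)

  -- One enumeration is enough, because the maximality hypothesis accepts any list of the subtrees.
  localMean : LocalMean G r (mean (treeTotal f) (count f))
  localMean = subtrees , Uniqueₚ.map⁺ subtree-injective (allClosed-unique f) , ∈-subtrees ,
    cong₂ mean (≡-sym sum-subtrees)
      (≡-sym (trans (Listₚ.length-map subtree (allClosed f)) (length-allClosed f)))

-- Brooms

-- Rationals are stored in lowest terms; passing to unnormalised fractions recovers the original
-- numerators and denominators.
mean-≤⁻ : ∀ {s k s′ k′} → 1 ≤ k → 1 ≤ k′ → mean s′ k′ ≤ℚ mean s k → s′ * k ≤ s * k′
mean-≤⁻ {s} {suc k} {s′} {suc k′} _ _ le
  with ℚᵘₚ.≤-respʳ-≃ (ℚₚ.toℚᵘ-fromℚᵘ (mkℚᵘ (ℤ.+ s) k))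
         (ℚᵘₚ.≤-respˡ-≃ (ℚₚ.toℚᵘ-fromℚᵘ (mkℚᵘ (ℤ.+ s′) k′)) (ℚₚ.toℚᵘ-mono-≤ le))
... | *≤* le′ = ℤₚ.drop‿+≤+ (subst₂ ℤ._≤_ (≡-sym (ℤₚ.pos-* s′ (suc k))) (≡-sym (ℤₚ.pos-* s (suc k′))) le′)

module _ {n : ℕ} (r : Fin n) where

  leaf-edges : ∀ {l : Forest (Fin n)} → Leaves l → ∀ {u v} → Edge r l u v ⇔ (u ≡ r × v ∈ labels l)
  leaf-edges isLeaves = mk⇔ (to isLeaves) (from isLeaves)
    where
    to : ∀ {l} → Leaves l → ∀ {u v} → Edge r l u v → u ≡ r × v ∈ labels l
    to (leaf _)  root        = refl , hd
    to (leaf ls) (sibling e) = let u≡r , i = to ls e in u≡r , tl i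
    from : ∀ {l} → Leaves l → ∀ {u v} → u ≡ r × v ∈ labels l → Edge r l u v
    from (leaf _)  (refl , hd)   = root
    from (leaf ls) (refl , tl i) = sibling (from ls (refl , i))

broom-edges : ∀ {n} (r : Fin n) ps {l} → Leaves l → ∀ {u v} →
  Edge r (prepend ps l) u v ⇔ (Consec (r ∷ ps) u v ⊎ (u ≡ lastOf r ps × v ∈ labels l))
broom-edges r ps isLeaves = mk⇔ (to r ps isLeaves) (from r ps isLeaves)
  where
  to : ∀ {n} (r : Fin n) ps {l} → Leaves l → ∀ {u v} → Edge r (prepend ps l) u v →
    Consec (r ∷ ps) u v ⊎ (u ≡ lastOf r ps × v ∈ labels l)
  to r []       ls e         = inj₂ (Equivalence.to (leaf-edges r ls) e)
  to r (a ∷ ps) ls root      = inj₁ now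
  to r (a ∷ ps) ls (child e) = [ inj₁ ∘ later , inj₂ ]′ (to a ps ls e)
  from : ∀ {n} (r : Fin n) ps {l} → Leaves l → ∀ {u v} →
    Consec (r ∷ ps) u v ⊎ (u ≡ lastOf r ps × v ∈ labels l) → Edge r (prepend ps l) u v
  from r []       ls (inj₂ e)         = Equivalence.from (leaf-edges r ls) e
  from r []       ls (inj₁ (later ()))
  from r (a ∷ ps) ls (inj₁ now)       = root
  from r (a ∷ ps) ls (inj₁ (later c)) = child (from a ps ls (inj₁ c))
  from r (a ∷ ps) ls (inj₂ e)         = child (from a ps ls (inj₂ e))

broom : ∀ {n} {G : Graph n} {r : Fin n} ps {l} → Leaves l → Realises G r (prepend ps l) → IsBroomFrom G r
broom {n} {G} {r} ps {l} isLeaves R = ps , proj₁ split , λ u v → mk⇔ to from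
  where
  open Realises R
  end = L⁺.last (r L⁺.∷ ps)
  labels≡ : r ∷ labels (prepend ps l) ≡ (r ∷ ps) ++ labels l
  labels≡ = cong (r ∷_) (labels-prepend ps l)
  split = unique-++⁻ (r ∷ ps) (subst Unique labels≡ unique)
  -- Every vertex occurs exactly once among the path and the leaves, so being a leaf and lying off
  -- the path coincide.
  leaf⇔ : ∀ {v} → v ∈ labels l ⇔ v ∉ r ∷ ps
  leaf⇔ {v} = mk⇔ (λ i j → proj₂ (proj₂ split) (j , i)) λ v∉ →
    [ ⊥-elim ∘ v∉ , (λ i → i) ]′ (∈-++⁻ (r ∷ ps) (subst (v ∈_) labels≡ (complete v)))
  Half : Fin n → Fin n → Set
  Half u v = Consec (r ∷ ps) u v ⊎ (u ≡ end × v ∉ r ∷ ps)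
  half⇔ : ∀ {u v} → Edge r (prepend ps l) u v ⇔ Half u v
  half⇔ = mk⇔
    (λ e → [ inj₁ , (λ { (u≡ , i) → inj₂ (trans u≡ (≡-sym (last≡lastOf r ps)) , Equivalence.to leaf⇔ i) }) ]′
      (Equivalence.to (broom-edges r ps isLeaves) e))
    λ h → Equivalence.from (broom-edges r ps isLeaves)
      ([ inj₁ , (λ { (u≡ , v∉) → inj₂ (trans u≡ (last≡lastOf r ps) , Equivalence.from leaf⇔ v∉) }) ]′ h)
  to : ∀ {u v} → Adj G u v →
    Consec (r ∷ ps) u v ⊎ Consec (r ∷ ps) v u ⊎ (u ≡ end × v ∉ r ∷ ps) ⊎ (v ≡ end × u ∉ r ∷ ps)
  to a with adj⇒edge a
  ... | inj₁ e = [ inj₁ , inj₂ ∘ inj₂ ∘ inj₁ ]′ (Equivalence.to half⇔ e)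
  ... | inj₂ e = [ inj₂ ∘ inj₁ , inj₂ ∘ inj₂ ∘ inj₂ ]′ (Equivalence.to half⇔ e)
  from : ∀ {u v} →
    Consec (r ∷ ps) u v ⊎ Consec (r ∷ ps) v u ⊎ (u ≡ end × v ∉ r ∷ ps) ⊎ (v ≡ end × u ∉ r ∷ ps) → Adj G u v
  from (inj₁ c)               = edge⇒adj (Equivalence.from half⇔ (inj₁ c))
  from (inj₂ (inj₁ c))        = Adj-sym {G = G} (edge⇒adj (Equivalence.from half⇔ (inj₁ c)))
  from (inj₂ (inj₂ (inj₁ h))) = edge⇒adj (Equivalence.from half⇔ (inj₂ h))
  from (inj₂ (inj₂ (inj₂ h))) = Adj-sym {G = G} (edge⇒adj (Equivalence.from half⇔ (inj₂ h)))

theorem1p3 : (n : ℕ) → 1 ≤ n → (T : Graph n) → IsTree T → (r : Fin n) →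
    ((T′ : Graph n) → IsTree T′ → (r′ : Fin n) → (q q′ : ℚ) →
    LocalMean T r q → LocalMean T′ r′ q′ → q′ ≤ℚ q) →
    IsBroomFrom T r
theorem1p3 n _ T isTree r max with isTree⇒realises T r isTree
... | f , R with maximal⇒broom r [] f maximal
  where
  open Realises R
  maximal : Maximal r f
  maximal r′ f′ labels≡ = mean-≤⁻ (count-positive f) (count-positive f′)
    (max T′ (realises⇒isTree R′) r′ _ _ (localMean R) (localMean R′))
    where
    uniq′ : Unique (r′ ∷ labels f′)
    uniq′ = unique-resp-↭ (↭-sym labels≡) unique
    -- The permutation of labels makes the competitor list every vertex of `Fin n` exactly once, so
    -- it is a tree to which `max` applies.
    T′ = treeGraph r′ f′ uniq′
    R′ : Realises T′ r′ f′
    R′ = treeGraph-realises r′ f′ uniq′ (λ v → ∈-resp-↭ (↭-sym labels≡) (complete v))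
...   | ps , l , isLeaves , refl = broom ps isLeaves R
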